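{- Let $I\subseteq\{0,\dots,\nu_\varepsilon\}$ be non-empty. The mapping $J\mapsto[v_J]_I$ defines an isomorphism of posets $\mathcal P_I\xrightarrow{\sim}\mathrm{Adm}(\{\mu'\})_I$, where $\mathcal P_I$ is the set of proper subsets of $\overline I$ ordered by inclusion.
   Context: $n\ge2$, $\varepsilon\in\{\pm1\}$, $\underline\varepsilon=(1-\varepsilon)/2$, $\nu_\varepsilon=\lfloor(n-\underline\varepsilon)/2\rfloor$; $\overline r\in\mathbb Z/n\mathbb Z$ is the class of $r\in\mathbb Z$. For non-empty $I\subseteq\{0,\dots,\nu_\varepsilon\}$ put $\overline I=\{\overline r,\overline{ -r-\underline\varepsilon}\mid r\in I\}\subseteq\mathbb Z/n\mathbb Z$, and for $i\in\overline I$ put $\ell_i=\min\{1\le\ell\le n\mid i+\ell\in\overline I\}$. Iwahori-Weyl group: $\widetilde W=(\mathbb Z^n\times\mathbb Z)\rtimes\mathfrak S_n$, with elements written $t^xw$ and $w\cdot(x_1,\dots,x_n;m)=(x_{w^{ -1}(1)},\dots,x_{w^{ -1}(n)};m)$. The affine Weyl group is $W_a=\{t^{(x_1,\dots,x_n;0)}w\mid\sum x_i=0\}$, a Coxeter group with simple reflections $\mathbb S_a=\{s_0,\dots,s_{n-1}\}$ indexed by $\mathbb Z/n\mathbb Z$: $s_j=(j\ j+1)$ for $1\le j\le n-1$ and $s_0=t^{(1,0,\dots,0,-1;0)}(1\ n)$. Put $\tau_0=t^{(1,\dots,1,0;1)}(n\ n-1\ \cdots\ 1)$, $\zeta=t^{(1,\dots,1;1)}$,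 $\Omega=\langle\tau_0,\zeta\rangle\simeq\mathbb Z^2$; then $\widetilde W=W_a\rtimes\Omega$ and $\tau_0s_j\tau_0^{ -1}=s_{j-1}$. Length and Bruhat order extend to $\widetilde W$ by $\ell(w\omega)=\ell(w)$, and $w\omega\le w'\omega'$ iff $\omega=\omega'$ and $w\le w'$ ($w,w'\in W_a$, $\omega,\omega'\in\Omega$). $\mathrm{Adm}(\{\mu'\})=\{v\in\widetilde W\mid v\le t^{(1^{j-1},0,1^{n-j};1)}\text{ for some }1\le j\le n\}$. $\mathbb S_a^I=\{s_i\mid i\notin\overline I\}$ and $W_{\mathbb S_a^I}=\langle\mathbb S_a^I\rangle$. $\mathrm{Adm}(\{\mu'\})_I$ is the image of $\mathrm{Adm}(\{\mu'\})$ in $W_{\mathbb S_a^I}\backslash\widetilde W/W_{\mathbb S_a^I}$; $[v]_I$ denotes the double coset of $v$, and $[v]_I\le[v']_I$ iff the minimal length element of $[v]_I$ is $\le$ the minimal length element of $[v']_I$ in the Bruhat order. For $i\in\overline I$ put $w_{B_i}=s_is_{i+1}\cdots s_{i+\ell_i-1}$. For $J\subsetneq\overline I$, pick $i_0\in\overline I\setminus J$ and enumerate $J=\{j_1,\dots,j_k\}$ in the order met when running through $i_0+1,i_0+2,\dots,i_0-1$ in $\mathbb Z/n\mathbb Z$; put $w_J=w_{B_{j_1}}\cdots w_{B_{j_k}}$ (independent of $i_0$) and $v_J=w_J\tau_0$. -}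

module Defs where

open import Algebra.Bundles using (Group)
open import Algebra.Structures using (IsGroup)
open import Data.Fin.Base using (Fin; toℕ; fromℕ<)
open import Data.Fin.Permutation as Perm
  using (Permutation′; permutation; transpose; _⟨$⟩ʳ_; _⟨$⟩ˡ_; _∘ₚ_; flip)
open import Data.Fin.Properties using (_≟_; toℕ-fromℕ<; toℕ-injective; toℕ<n)
open import Data.Fin.Subset
  using (Subset; _∈_; _∉_; _⊆_; _⊂_; _∪_; ⁅_⁆; ⋃)
open import Data.Fin.Subset.Properties using (_∈?_)
open import Data.Integer.Base as ℤ using (ℤ; +_; -[1+_]; 0ℤ; 1ℤ)
open import Data.Integer.DivMod using (_%ℕ_; _/ℕ_; n%ℕd<d; a≡a%ℕn+[a/ℕn]*n)
import Data.Integer.Properties as ℤ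
open import Data.Integer.Tactic.RingSolver using (solve-∀)
open import Data.List.Base
  using (List; []; _∷_; length; map; foldr; filter; find; upTo; allFin)
open import Data.Maybe.Base using (fromMaybe)
open import Data.Nat.Base as ℕ
  using (ℕ; suc; _∸_; NonZero; NonTrivial; nonTrivial⇒nonZero)
import Data.Nat.DivMod as ℕ
open import Data.Product.Base using (Σ; Σ-syntax; ∃; ∃-syntax; _×_; _,_; proj₁; proj₂)
open import Data.Sign.Base using (Sign)
open import Data.Vec.Functional using (Vector)
open import Function.Base using (_on_)
open import Level using (0ℓ; _⊔_)
open import Relation.Binary.Construct.Closure.ReflexiveTransitive using (Star)
open import Relation.Binary.Construct.Union renaming (_∪_ to _∪ᵣ_)
open import Relation.Binary.Core using (Rel)
open import Relation.Binary.PropositionalEquality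
  using (_≡_; refl; sym; trans; cong; cong₂; module ≡-Reasoning)
open import Relation.Nullary.Decidable using (does)
open import Relation.Unary using (Pred) renaming (_∈_ to _∈ₚ_)
open import Algebra.Properties.CommutativeMonoid.Sum ℤ.+-0-commutativeMonoid using (sum)
open import Data.Bool.Base using (if_then_else_)

-- The subgroup generated by a set of elements.
module _ {c ℓ} (G : Group c ℓ) where
  open Group G

  data Generated {p} (S : Pred Carrier p) : Pred Carrier (c ⊔ ℓ ⊔ p) where
    gen  : ∀ {g} → S g → Generated S g
    unit : Generated S ε
    mul  : ∀ {g h} → Generated S g → Generated S h → Generated S (g ∙ h)
    inv  : ∀ {g} → Generated S g → Generated S (g ⁻¹)
    resp : ∀ {g h} → g ≈ h → Generated S g → Generated S h

-- ε̲ = (1 − ε) / 2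
half : Sign → ℕ
half Sign.+ = 0
half Sign.- = 1

ν : ℕ → Sign → ℕ
ν n ε = (n ∸ half ε) ℕ./ 2

module IwahoriWeyl (n : ℕ) .{{_ : NonTrivial n}} where

  private instance
    n≢0 : NonZero n
    n≢0 = nonTrivial⇒nonZero n

  -- ℤ/nℤ, represented by the residues 0, …, n − 1.
  ℤ/n : Set
  ℤ/n = Fin n

  class : ℤ → ℤ/n
  class r = fromℕ< (n%ℕd<d r n)

  infixl 6 _⊕_
  _⊕_ : ℤ/n → ℤ → ℤ/n
  i ⊕ k = class (+ toℕ i ℤ.+ k)

  private
    remainder-unique⁺ : ∀ {r r′} k → r ℕ.< n → r′ ℕ.< n →
                        + r ≡ + r′ ℤ.+ + k ℤ.* + n → r ≡ r′
    remainder-unique⁺ {r} {r′} k r<n r′<n eq = begin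
      r                       ≡⟨ ℕ.m<n⇒m%n≡m r<n ⟨
      r ℕ.% n                 ≡⟨ cong (ℕ._% n) (ℤ.+-injective
                                   (trans eq (cong (λ a → + r′ ℤ.+ a) (sym (ℤ.pos-* k n))))) ⟩
      (r′ ℕ.+ k ℕ.* n) ℕ.% n  ≡⟨ ℕ.[m+kn]%n≡m%n r′ k n ⟩
      r′ ℕ.% n                ≡⟨ ℕ.m<n⇒m%n≡m r′<n ⟩
      r′                      ∎
      where open ≡-Reasoning

    remainder-unique : ∀ {r r′} q → r ℕ.< n → r′ ℕ.< n →
                       + r ≡ + r′ ℤ.+ q ℤ.* + n → r ≡ r′
    remainder-unique (+ k) r<n r′<n eq = remainder-unique⁺ k r<n r′<n eq
    remainder-unique {r} {r′} -[1+ k ] r<n r′<n eq =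
      sym (remainder-unique⁺ (suc k) r′<n r<n
        (trans (rearrange (+ r′) -[1+ k ] (+ n))
               (cong (ℤ._+ + suc k ℤ.* + n) (sym eq))))
      where
      rearrange : ∀ a b c → a ≡ (a ℤ.+ b ℤ.* c) ℤ.+ (ℤ.- b) ℤ.* c
      rearrange = solve-∀

  class-cong : ∀ {a b} q → a ≡ b ℤ.+ q ℤ.* + n → class a ≡ class b
  class-cong {a} {b} q eq = toℕ-injective (begin
    toℕ (class a)  ≡⟨ toℕ-fromℕ< _ ⟩
    a %ℕ n         ≡⟨ remainder-unique (b /ℕ n ℤ.+ q ℤ.- a /ℕ n)
                        (n%ℕd<d a n) (n%ℕd<d b n) key ⟩
    b %ℕ n         ≡⟨ toℕ-fromℕ< _ ⟨
    toℕ (class b)  ∎)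
    where
    open ≡-Reasoning
    isolate : ∀ r q d → r ≡ (r ℤ.+ q ℤ.* d) ℤ.- q ℤ.* d
    isolate = solve-∀
    collect : ∀ r q₁ q₂ q₃ d →
      ((r ℤ.+ q₁ ℤ.* d) ℤ.+ q₂ ℤ.* d) ℤ.- q₃ ℤ.* d ≡
      r ℤ.+ (q₁ ℤ.+ q₂ ℤ.- q₃) ℤ.* d
    collect = solve-∀
    key : + (a %ℕ n) ≡ + (b %ℕ n) ℤ.+ (b /ℕ n ℤ.+ q ℤ.- a /ℕ n) ℤ.* + n
    key = begin
      + (a %ℕ n)
        ≡⟨ isolate _ (a /ℕ n) (+ n) ⟩
      (+ (a %ℕ n) ℤ.+ a /ℕ n ℤ.* + n) ℤ.- a /ℕ n ℤ.* + n
        ≡⟨ cong (ℤ._- a /ℕ n ℤ.* + n) (a≡a%ℕn+[a/ℕn]*n a n) ⟨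
      a ℤ.- a /ℕ n ℤ.* + n
        ≡⟨ cong (ℤ._- a /ℕ n ℤ.* + n) eq ⟩
      (b ℤ.+ q ℤ.* + n) ℤ.- a /ℕ n ℤ.* + n
        ≡⟨ cong (λ b′ → (b′ ℤ.+ q ℤ.* + n) ℤ.- a /ℕ n ℤ.* + n) (a≡a%ℕn+[a/ℕn]*n b n) ⟩
      ((+ (b %ℕ n) ℤ.+ b /ℕ n ℤ.* + n) ℤ.+ q ℤ.* + n) ℤ.- a /ℕ n ℤ.* + n
        ≡⟨ collect (+ (b %ℕ n)) (b /ℕ n) q (a /ℕ n) (+ n) ⟩
      + (b %ℕ n) ℤ.+ (b /ℕ n ℤ.+ q ℤ.- a /ℕ n) ℤ.* + n
        ∎

  class-toℕ : ∀ i → class (+ toℕ i) ≡ i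
  class-toℕ i = toℕ-injective (trans (toℕ-fromℕ< _) (ℕ.m<n⇒m%n≡m (toℕ<n i)))

  ⊕-inverse : ∀ k i → (i ⊕ k) ⊕ (ℤ.- k) ≡ i
  ⊕-inverse k i = trans (class-cong {b = + toℕ i} (ℤ.- q) eq) (class-toℕ i)
    where
    open ≡-Reasoning
    a = + toℕ i ℤ.+ k
    q = a /ℕ n
    rearrange : ∀ r k q d → r ℤ.+ (ℤ.- k) ≡ (r ℤ.+ q ℤ.* d) ℤ.- k ℤ.+ (ℤ.- q) ℤ.* d
    rearrange = solve-∀
    cancel : ∀ i k c → (i ℤ.+ k) ℤ.- k ℤ.+ c ≡ i ℤ.+ c
    cancel = solve-∀
    eq : + toℕ (i ⊕ k) ℤ.+ (ℤ.- k) ≡ + toℕ i ℤ.+ (ℤ.- q) ℤ.* + n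
    eq = begin
      + toℕ (class a) ℤ.+ (ℤ.- k)
        ≡⟨ cong (λ r → + r ℤ.+ (ℤ.- k)) (toℕ-fromℕ< _) ⟩
      + (a %ℕ n) ℤ.+ (ℤ.- k)
        ≡⟨ rearrange (+ (a %ℕ n)) k q (+ n) ⟩
      (+ (a %ℕ n) ℤ.+ q ℤ.* + n) ℤ.- k ℤ.+ (ℤ.- q) ℤ.* + n
        ≡⟨ cong (λ b → b ℤ.- k ℤ.+ (ℤ.- q) ℤ.* + n) (a≡a%ℕn+[a/ℕn]*n a n) ⟨
      a ℤ.- k ℤ.+ (ℤ.- q) ℤ.* + n
        ≡⟨ cancel (+ toℕ i) k ((ℤ.- q) ℤ.* + n) ⟩
      + toℕ i ℤ.+ (ℤ.- q) ℤ.* + n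
        ∎

  -- The group (ℤⁿ × ℤ) ⋊ 𝔖ₙ; the record (x , m , w) is t^(x;m) w.  The index
  -- set {1, …, n} of the coordinates, on which 𝔖ₙ acts, is identified with
  -- ℤ/n by taking residues, so that the last index n is the residue 0.
  record W̃ : Set where
    constructor t⟨_⨾_⟩_
    field
      vec  : Vector ℤ n
      sim  : ℤ
      perm : Permutation′ n
  open W̃ public

  infix 4 _≈_
  record _≈_ (u v : W̃) : Set where
    constructor mk≈
    field
      vec≈  : ∀ i → vec u i ≡ vec v i
      sim≈  : sim u ≡ sim v
      perm≈ : perm u Perm.≈ perm v
  open _≈_ public

  infixl 7 _∙_
  -- The library's π ∘ₚ ρ applies π first, hence the order of the permutations.
  _∙_ : W̃ → W̃ → W̃
  u ∙ v = record
    { vec  = λ i → vec u i ℤ.+ vec v (perm u ⟨$⟩ˡ i)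
    ; sim  = sim u ℤ.+ sim v
    ; perm = perm v ∘ₚ perm u
    }

  𝟙 : W̃
  𝟙 = t⟨ (λ _ → 0ℤ) ⨾ 0ℤ ⟩ Perm.id

  infix 8 _⁻¹
  _⁻¹ : W̃ → W̃
  u ⁻¹ = record
    { vec  = λ i → ℤ.- vec u (perm u ⟨$⟩ʳ i)
    ; sim  = ℤ.- sim u
    ; perm = flip (perm u)
    }

  private
    inverse-cong : ∀ {π ρ : Permutation′ n} → π Perm.≈ ρ → ∀ i → π ⟨$⟩ˡ i ≡ ρ ⟨$⟩ˡ i
    inverse-cong {π} {ρ} π≈ρ i = begin
      π ⟨$⟩ˡ i                      ≡⟨ cong (π ⟨$⟩ˡ_) (Perm.inverseʳ ρ) ⟨
      π ⟨$⟩ˡ (ρ ⟨$⟩ʳ (ρ ⟨$⟩ˡ i))    ≡⟨ cong (π ⟨$⟩ˡ_) (π≈ρ (ρ ⟨$⟩ˡ i)) ⟨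
      π ⟨$⟩ˡ (π ⟨$⟩ʳ (ρ ⟨$⟩ˡ i))    ≡⟨ Perm.inverseˡ π ⟩
      ρ ⟨$⟩ˡ i                      ∎
      where open ≡-Reasoning

  W̃-isGroup : IsGroup _≈_ _∙_ 𝟙 _⁻¹
  W̃-isGroup = record
    { isMonoid = record
      { isSemigroup = record
        { isMagma = record
          { isEquivalence = record
            { refl  = mk≈ (λ _ → refl) refl (λ _ → refl)
            ; sym   = λ p → mk≈ (λ i → sym (vec≈ p i)) (sym (sim≈ p))
                                (λ i → sym (perm≈ p i))
            ; trans = λ p q → mk≈ (λ i → trans (vec≈ p i) (vec≈ q i))
                                  (trans (sim≈ p) (sim≈ q))
                                  (λ i → trans (perm≈ p i) (perm≈ q i))
            }
          ; ∙-cong = λ {u} {u′} {v} {v′} p q → mk≈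
              (λ i → cong₂ ℤ._+_ (vec≈ p i)
                (trans (vec≈ q _)
                       (cong (vec v′) (inverse-cong {perm u} {perm u′} (perm≈ p) i))))
              (cong₂ ℤ._+_ (sim≈ p) (sim≈ q))
              (λ i → trans (cong (perm u ⟨$⟩ʳ_) (perm≈ q i)) (perm≈ p _))
          }
        ; assoc = λ u v w → mk≈ (λ _ → ℤ.+-assoc (vec u _) _ _)
                                (ℤ.+-assoc (sim u) _ _) (λ _ → refl)
        }
      ; identity = (λ u → mk≈ (λ _ → ℤ.+-identityˡ _) (ℤ.+-identityˡ _) (λ _ → refl))
                 , (λ u → mk≈ (λ _ → ℤ.+-identityʳ _) (ℤ.+-identityʳ _) (λ _ → refl))
      }
    ; inverse = (λ u → mk≈ (λ _ → ℤ.+-inverseˡ (vec u _)) (ℤ.+-inverseˡ (sim u))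
                           (λ _ → Perm.inverseˡ (perm u)))
              , (λ u → mk≈ (λ i → trans (cong (λ j → vec u i ℤ.- vec u j)
                                              (Perm.inverseʳ (perm u)))
                                        (ℤ.+-inverseʳ (vec u i)))
                           (ℤ.+-inverseʳ (sim u))
                           (λ _ → Perm.inverseʳ (perm u)))
    ; ⁻¹-cong = λ {u} {u′} p → mk≈
        (λ i → cong ℤ.-_ (trans (vec≈ p _) (cong (vec u′) (perm≈ p i))))
        (cong ℤ.-_ (sim≈ p))
        (inverse-cong {perm u} {perm u′} (perm≈ p))
    }

  W̃-group : Group 0ℓ 0ℓ
  W̃-group = record { isGroup = W̃-isGroup }

  Wₐ : Pred W̃ 0ℓ
  Wₐ u = sum (vec u) ≡ 0ℤ × sim u ≡ 0ℤ

  -- The standard basis vector with index j.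
  e : ℤ/n → Vector ℤ n
  e j i = if does (i ≟ j) then 1ℤ else 0ℤ

  s : ℤ/n → W̃
  s j = t⟨ vector ⨾ 0ℤ ⟩ transpose j (j ⊕ 1ℤ)
    where
    vector : Vector ℤ n
    vector i = if does (j ≟ class 0ℤ) then e (class 1ℤ) i ℤ.- e (class (+ n)) i else 0ℤ

  -- (1^(j−1), 0, 1^(n−j))
  1-e : ℤ/n → Vector ℤ n
  1-e j i = 1ℤ ℤ.- e j i

  -- The cycle (n n−1 ⋯ 1), which maps i to i − 1.
  cycle : Permutation′ n
  cycle = permutation (_⊕ ℤ.- 1ℤ) (_⊕ 1ℤ) (⊕-inverse 1ℤ) (⊕-inverse (ℤ.- 1ℤ))

  τ₀ : W̃
  τ₀ = t⟨ 1-e (class (+ n)) ⨾ 1ℤ ⟩ cycle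

  ζ : W̃
  ζ = t⟨ (λ _ → 1ℤ) ⨾ 1ℤ ⟩ Perm.id

  data Ω-generator : Pred W̃ 0ℓ where
    gen-τ₀ : Ω-generator τ₀
    gen-ζ  : Ω-generator ζ

  Ω : Pred W̃ 0ℓ
  Ω = Generated W̃-group Ω-generator

  ∏ : List W̃ → W̃
  ∏ = foldr _∙_ 𝟙

  IsReducedWord : List ℤ/n → W̃ → Set
  IsReducedWord js w =
    ∏ (map s js) ≈ w × (∀ js′ → ∏ (map s js′) ≈ w → length js ℕ.≤ length js′)

  -- The Coxeter length on Wₐ, as a relation: HasLengthₐ w k means ℓ(w) = k.
  HasLengthₐ : W̃ → ℕ → Set
  HasLengthₐ w k = ∃[ js ] IsReducedWord js w × length js ≡ k

  Reflection : Pred W̃ 0ℓ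
  Reflection t = ∃[ w ] ∃[ j ] w ∈ₚ Wₐ × t ≈ w ∙ s j ∙ w ⁻¹

  -- u ⇝ v if v = u t for a reflection t, and ℓ(u) < ℓ(v).
  infix 4 _⇝_ _≤ₐ_ _≤_
  _⇝_ : Rel W̃ 0ℓ
  u ⇝ v = ∃[ t ] Reflection t × v ≈ u ∙ t ×
          ∃[ k ] ∃[ l ] HasLengthₐ u k × HasLengthₐ v l × k ℕ.< l

  _≤ₐ_ : Rel W̃ 0ℓ
  _≤ₐ_ = Star (_≈_ ∪ᵣ _⇝_)

  HasLength : W̃ → ℕ → Set
  HasLength v k =
    ∃[ w ] ∃[ ω ] w ∈ₚ Wₐ × ω ∈ₚ Ω × v ≈ w ∙ ω × HasLengthₐ w k

  _≤_ : Rel W̃ 0ℓ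
  v ≤ v′ = ∃[ w ] ∃[ ω ] ∃[ w′ ] ∃[ ω′ ]
           (w ∈ₚ Wₐ × ω ∈ₚ Ω × v ≈ w ∙ ω) ×
           (w′ ∈ₚ Wₐ × ω′ ∈ₚ Ω × v′ ≈ w′ ∙ ω′) ×
           ω ≈ ω′ × w ≤ₐ w′

  Adm : Pred W̃ 0ℓ
  Adm v = ∃[ j ] v ≤ t⟨ 1-e j ⨾ 1ℤ ⟩ Perm.id

  -- Ī ⊆ ℤ/n
  overline : (ε : Sign) → Subset (suc (ν n ε)) → Subset n
  overline ε I = ⋃ (map classes (filter (_∈? I) (allFin _)))
    where
    classes : Fin (suc (ν n ε)) → Subset n
    classes r = ⁅ class (+ toℕ r) ⁆ ∪ ⁅ class (ℤ.- (+ toℕ r) ℤ.- + half ε) ⁆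

  -- The definitions below depend on I only through Ī.
  module Parahoric (Ī : Subset n) where

    data S^I : Pred W̃ 0ℓ where
      simple : ∀ {i} → i ∉ Ī → S^I (s i)

    W_I : Pred W̃ 0ℓ
    W_I = Generated W̃-group S^I

    -- Equality of the double cosets W_I u W_I and W_I v W_I.
    infix 4 _∼_ _≤∼_
    _∼_ : Rel W̃ 0ℓ
    u ∼ v = ∃[ a ] ∃[ b ] a ∈ₚ W_I × b ∈ₚ W_I × u ≈ a ∙ v ∙ b

    IsMinimalIn : W̃ → W̃ → Set
    IsMinimalIn v u = u ∼ v × ∃[ k ] HasLength u k ×
                      (∀ u′ l → u′ ∼ v → HasLength u′ l → k ℕ.≤ l)

    -- [v] ≤ [v′]
    _≤∼_ : Rel W̃ 0ℓ
    v ≤∼ v′ = ∃[ u ] ∃[ u′ ] IsMinimalIn v u × IsMinimalIn v′ u′ × u ≤ u′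

    -- v represents a double coset in the image of Adm.
    Admissible : Pred W̃ 0ℓ
    Admissible v = ∃[ a ] a ∈ₚ Adm × v ∼ a

    Adm_I : Set
    Adm_I = Σ W̃ Admissible

    _≈Adm_ _≤Adm_ : Rel Adm_I 0ℓ
    _≈Adm_ = _∼_ on proj₁
    _≤Adm_ = _≤∼_ on proj₁

    -- By definition of _⊂_, an element (J , J⊆Ī , i₀ , i₀∈Ī , i₀∉J) comes with
    -- a choice of i₀ ∈ Ī ∖ J, which the equality _≈P_ ignores.
    P_I : Set
    P_I = Σ[ J ∈ Subset n ] J ⊂ Ī

    _≈P_ _≤P_ : Rel P_I 0ℓ
    _≈P_ = _≡_ on proj₁
    _≤P_ = _⊆_ on proj₁

    -- min {1 ≤ ℓ ≤ n | i + ℓ ∈ Ī}; the default value is never used if i ∈ Ī,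
    -- as then ℓ = n qualifies.
    gap : ℤ/n → ℕ
    gap i = fromMaybe n (find (λ ℓ → (i ⊕ + ℓ) ∈? Ī) (map suc (upTo n)))

    w-B : ℤ/n → W̃
    w-B i = ∏ (map (λ k → s (i ⊕ + k)) (upTo (gap i)))

    w : (J : Subset n) (i₀ : ℤ/n) → W̃
    w J i₀ = ∏ (map w-B (filter (_∈? J) (map (λ k → i₀ ⊕ + suc k) (upTo (n ∸ 1)))))

    v : P_I → W̃
    v (J , _ , i₀ , _) = w J i₀ ∙ τ₀

{-# OPTIONS --safe #-}

-- W̃ acts on ℤ by affine permutations: sⱼ exchanges x and x + 1 for all x of class
-- j, and τ₀ is the translation by n − 1.  Call a word in distinct letters ordered
-- if x + 1 never precedes x in it.  Its product maps m to m + 1 for every letter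
-- m, which an element with a word omitting m cannot do, as it preserves
-- {y ≤ m}.  So ordered words are reduced, and by commutations their products
-- depend only on their letters.  All t^μ in the definition of Adm have the form
-- w τ₀ with w the product of an ordered word of length n − 1, hence by the strong
-- exchange property Adm consists of the w τ₀ with w the product of a subword.
-- From such a w τ₀ every letter can be moved into W_I on the left or right,
-- except for those of the blocks that are entirely present, which leaves a v_J.
-- As W_I preserves {y ≤ m} for m of class in Ī, every word of an element of the
-- double coset of v_J contains all letters of w_J.  So v_J has minimal length, and
-- the Bruhat order, given by subwords, reflects inclusion.

module Submission where

open import Defs
open import Data.Fin.Subset using (Subset; Nonempty)
open import Data.Nat.Base using (ℕ; suc; NonTrivial)
open import Data.Product.Base using (Σ; _,_)
open import Data.Sign.Base using (Sign)
open import Relation.Binary.Morphism.Structures using (IsOrderIsomorphism)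

open import Algebra.Bundles using (Group)
open import Data.Bool.Base using (if_then_else_)
open import Data.Empty using (⊥-elim)
open import Data.Fin.Base using (Fin; zero; suc; toℕ)
open import Data.Fin.Permutation as Perm using (_⟨$⟩ʳ_; _⟨$⟩ˡ_)
open import Data.Fin.Properties using (_≟_; any?; toℕ-fromℕ<; toℕ<n)
open import Data.Fin.Subset using (_∈_; _∉_; _⊆_; _∪_; ⁅_⁆; ⋃)
open import Data.Fin.Subset.Properties using (_∈?_; ⊆-antisym; p⊆p∪q; q⊆p∪q; x∈⁅x⁆)
open import Data.Integer.Base as ℤ using (ℤ; +_; -[1+_]; 0ℤ; 1ℤ; _+_; _*_; _-_; -_)
open import Data.Integer.DivMod using (_%ℕ_; _/ℕ_; n%ℕd<d; a≡a%ℕn+[a/ℕn]*n)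
import Data.Integer.Properties as ℤ
open import Data.Integer.Tactic.RingSolver using (solve-∀)
open import Data.List.Base as List
  using (List; []; _∷_; _++_; length; map; concat; applyUpTo; upTo; filter; find)
import Data.List.Membership.DecPropositional as DecMembership
open import Data.List.Membership.Propositional
  using () renaming (_∈_ to _∈ˡ_; _∉_ to _∉ˡ_; find to find-∈; lose to lose-∈)
open import Data.List.Membership.Propositional.Properties
  using (∈-∃++; ∈-++⁺ˡ; ∈-++⁺ʳ; ∈-++⁻; ∈-map⁺; ∈-map⁻; ∈-filter⁺; ∈-filter⁻;
         ∈-upTo⁺; ∈-upTo⁻; ∈-concat⁺′; ∈-concat⁻′; ∈-allFin)
open import Data.List.Properties using (++-assoc; map-upTo; map-∘)
open import Data.List.Relation.Binary.Sublist.Propositional as Sub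
  using ([]; _∷_; _∷ʳ_; ⊆-refl) renaming (_⊆_ to _⊑_)
open import Data.List.Relation.Binary.Sublist.Propositional.Properties using (All-resp-⊆; filter-⊆)
open import Data.List.Relation.Unary.All as All using (All; []; _∷_)
import Data.List.Relation.Unary.All.Properties as All
open import Data.List.Relation.Unary.AllPairs as AllPairs using (AllPairs; []; _∷_)
import Data.List.Relation.Unary.AllPairs.Properties as AllPairs
open import Data.List.Relation.Unary.Any using (Any; here; there) renaming (any? to anyˡ?)
open import Data.List.Relation.Unary.Unique.Propositional using (Unique)
open import Data.Maybe.Base using (fromMaybe)
open import Data.Nat.Base as ℕ using (NonZero; nonTrivial⇒nonZero; nonTrivial⇒n>1)
import Data.Nat.DivMod as ℕ
import Data.Nat.Properties as ℕ
open import Data.Product.Base using (∃; ∃-syntax; _×_; proj₁; proj₂)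
open import Data.Sum.Base using (_⊎_; inj₁; inj₂)
open import Data.Vec.Base using (tabulate)
open import Data.Vec.Functional using (Vector)
open import Data.Vec.Properties using (lookup∘tabulate; lookup⇒[]=; []=⇒lookup)
open import Function.Base using (_∘_; id)
open import Relation.Binary.Construct.Closure.ReflexiveTransitive using (_◅_; _◅◅_) renaming (ε to nil)
open import Relation.Binary.Definitions using (Tri; tri<; tri≈; tri>)
open import Relation.Binary.PropositionalEquality
  using (_≡_; _≢_; refl; sym; trans; cong; cong₂; subst; subst₂; module ≡-Reasoning)
import Relation.Binary.Reasoning.Setoid as SetoidReasoning
open import Relation.Nullary using (¬_; Dec; yes; no; contradiction)
open import Relation.Nullary.Decidable
  using (does; dec-true; dec-false; ¬?; _×-dec_; _⊎-dec_; decidable-stable)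
open import Relation.Unary using (Pred; Decidable)
open import Algebra.Properties.AbelianGroup ℤ.+-0-abelianGroup
  using () renaming (∙-cancelˡ to +-cancelˡ; ∙-cancelʳ to +-cancelʳ)
open import Algebra.Properties.CommutativeMonoid.Sum ℤ.+-0-commutativeMonoid
  using (sum; ∑-distrib-+; sum-permute; sum-cong-≗; sum-replicate-zero)

-- The shift by τ₀ is what shapes the blocks. A letter x leaves on the left as `s x`, but on the
-- right as `s (x ⊕ 1ℤ)`, since τ₀ lowers classes by one. A complete block is therefore stuck at
-- both ends: its first letter lies in `Ī`, and so does the successor of its last. If a letter of
-- the block is absent, those before the hole leave on the right and those after it on the left.
--
-- An ordered word cannot contain all n letters, because the order would run around the circle. The
-- absent letter is where the circle is cut; it is the reason for proper subsets, and it has to be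
-- carried along until it yields an element of `Ī` outside J.
--
-- `_≤∼_` speaks of some minimal elements of the two double cosets, not of the representatives v_J.
-- Comparing sets of letters deals with any such choice. Lengths are computed only for ordered
-- words; for all other elements the definition of the Bruhat order is used through subwords of
-- arbitrary words.

module AffineAction (n : ℕ) .{{_ : NonTrivial n}} where
  open IwahoriWeyl n
  open ≡-Reasoning

  private instance
    n≢0 : NonZero n
    n≢0 = nonTrivial⇒nonZero n

  -- Residue classes, windows, and the action on the integers.

  toℕ-class : ∀ x → toℕ (class x) ≡ x %ℕ n
  toℕ-class x = toℕ-fromℕ< (n%ℕd<d x n)

  toℕ-class-< : ∀ {k} → k ℕ.< n → toℕ (class (+ k)) ≡ k
  toℕ-class-< {k} k<n = trans (toℕ-class (+ k)) (ℕ.m<n⇒m%n≡m k<n)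

  divide : ∀ x → x ≡ + toℕ (class x) + x /ℕ n * + n
  divide x = trans (a≡a%ℕn+[a/ℕn]*n x n)
    (cong (λ r → + r + x /ℕ n * + n) (sym (toℕ-class x)))

  class-injective : ∀ x y → class x ≡ class y → ∃[ k ] x ≡ y + k * + n
  class-injective x y eq = x /ℕ n - y /ℕ n , (begin
    x                                       ≡⟨ divide x ⟩
    + toℕ (class x) + x /ℕ n * + n          ≡⟨ cong (λ i → + toℕ i + x /ℕ n * + n) eq ⟩
    + toℕ (class y) + x /ℕ n * + n          ≡⟨ regroup (+ toℕ (class y)) (x /ℕ n) (y /ℕ n) (+ n) ⟩
    + toℕ (class y) + y /ℕ n * + n + (x /ℕ n - y /ℕ n) * + n
                                            ≡⟨ cong (_+ (x /ℕ n - y /ℕ n) * + n) (divide y) ⟨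
    y + (x /ℕ n - y /ℕ n) * + n             ∎)
    where
    regroup : ∀ r a b d → r + a * d ≡ r + b * d + (a - b) * d
    regroup = solve-∀

  class-⊕ : ∀ x k → class x ⊕ k ≡ class (x + k)
  class-⊕ x k = class-cong {b = x + k} (- (x /ℕ n)) (trans (regroup (+ toℕ (class x)) k (x /ℕ n) (+ n))
    (cong (λ y → y + k + (- (x /ℕ n)) * + n) (sym (divide x))))
    where
    regroup : ∀ r k q d → r + k ≡ r + q * d + k + (- q) * d
    regroup = solve-∀

  class-shift : ∀ x k → class (x + k * + n) ≡ class x
  class-shift x k = class-cong {b = x} k refl

  class-suc : ∀ x → class (ℤ.suc x) ≡ class x ⊕ 1ℤ
  class-suc x = sym (trans (class-⊕ x 1ℤ) (cong class (ℤ.+-comm x 1ℤ)))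

  class-n : class (+ n) ≡ class 0ℤ
  class-n = class-cong {b = 0ℤ} 1ℤ (sym (trans (ℤ.+-identityˡ _) (ℤ.*-identityˡ (+ n))))

  ⊕1-injective : ∀ {a b} → a ⊕ 1ℤ ≡ b ⊕ 1ℤ → a ≡ b
  ⊕1-injective {a} {b} p = trans (sym (⊕-inverse 1ℤ a)) (trans (cong (_⊕ - 1ℤ) p) (⊕-inverse 1ℤ b))

  1<n : 1 ℕ.< n
  1<n = nonTrivial⇒n>1 n

  ⊕1-≢ : ∀ i → i ⊕ 1ℤ ≢ i
  ⊕1-≢ i eq with class-injective (+ toℕ i + 1ℤ) (+ toℕ i) (trans eq (sym (class-toℕ i)))
  ... | k , p = absurd k (+-cancelˡ (+ toℕ i) _ _ p)
    where
    absurd : ∀ k → 1ℤ ≢ k * + n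
    absurd (+ 0)         ()
    absurd (+ suc k)     q = ℕ.<⇒≢ (ℕ.<-≤-trans 1<n (ℕ.m≤m+n n (k ℕ.* n)))
                               (ℤ.+-injective (trans q (sym (ℤ.pos-* (suc k) n))))
    absurd -[1+ k ]      q with trans q (trans (sym (ℤ.neg-distribˡ-* (+ suc k) (+ n)))
                                               (cong -_ (sym (ℤ.pos-* (suc k) n))))
    ... | r with suc k ℕ.* n
    absurd -[1+ k ] q | () | 0
    absurd -[1+ k ] q | () | suc _

  e-≡ : ∀ j → e j j ≡ 1ℤ
  e-≡ j = cong (if_then 1ℤ else 0ℤ) (dec-true (j ≟ j) refl)

  e-≢ : ∀ {i j} → i ≢ j → e j i ≡ 0ℤ
  e-≢ {i} {j} i≢j = cong (if_then 1ℤ else 0ℤ) (dec-false (i ≟ j) i≢j)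

  -- The index of the window containing x. The coordinate n is represented by the residue 0, so a
  -- multiple of n closes a window instead of opening the next; hence the correction of the
  -- quotient.
  level : ℤ → ℤ
  level x = x /ℕ n - e (class 0ℤ) (class x)

  -- The integer with residue i in the a-th window {a n + 1, …, a n + n}.
  opaque
    pt : ℤ/n → ℤ → ℤ
    pt i a = + toℕ i + (a + e (class 0ℤ) i) * + n

    pt-def : ∀ i a → pt i a ≡ + toℕ i + (a + e (class 0ℤ) i) * + n
    pt-def i a = refl

  pt-class-level : ∀ x → pt (class x) (level x) ≡ x
  pt-class-level x = trans (pt-def (class x) (level x)) (trans
    (regroup (+ toℕ (class x)) (x /ℕ n) (e (class 0ℤ) (class x)) (+ n)) (sym (divide x)))
    where
    regroup : ∀ r q d m → r + (q - d + d) * m ≡ r + q * m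
    regroup = solve-∀

  class-pt : ∀ i a → class (pt i a) ≡ i
  class-pt i a = trans (cong class (pt-def i a))
    (trans (class-shift (+ toℕ i) (a + e (class 0ℤ) i)) (class-toℕ i))

  pt-injectiveʳ : ∀ i {a b} → pt i a ≡ pt i b → a ≡ b
  pt-injectiveʳ i {a} {b} eq =
    +-cancelʳ (e (class 0ℤ) i) a b
      (ℤ.*-cancelʳ-≡ _ _ (+ n) (+-cancelˡ (+ toℕ i) _ _
        (trans (sym (pt-def i a)) (trans eq (pt-def i b)))))

  pt-shift : ∀ i a k → pt i (a + k) ≡ pt i a + k * + n
  pt-shift i a k = trans (pt-def i (a + k))
    (trans (regroup (+ toℕ i) a k (e (class 0ℤ) i) (+ n)) (cong (_+ k * + n) (sym (pt-def i a))))
    where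
    regroup : ∀ r a k d m → r + (a + k + d) * m ≡ r + (a + d) * m + k * m
    regroup = solve-∀

  suc-pt : ∀ i a → ℤ.suc (pt i a) ≡ pt (i ⊕ 1ℤ) (a + e (class 0ℤ) i)
  suc-pt i a with ℕ.m≤n⇒m<n∨m≡n (toℕ<n i)
  ... | inj₁ 1+i<n = sym (begin
    pt (i ⊕ 1ℤ) (a + d)
      ≡⟨ pt-def (i ⊕ 1ℤ) (a + d) ⟩
    + toℕ (i ⊕ 1ℤ) + (a + d + e (class 0ℤ) (i ⊕ 1ℤ)) * + n
      ≡⟨ cong₂ (λ r d′ → + r + (a + d + d′) * + n) next (e-≢ next≢0) ⟩
    1ℤ + + toℕ i + (a + d + 0ℤ) * + n
      ≡⟨ regroup (+ toℕ i) (a + d) (+ n) ⟩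
    1ℤ + (+ toℕ i + (a + d) * + n)
      ≡⟨ cong ℤ.suc (pt-def i a) ⟨
    ℤ.suc (pt i a)
      ∎)
    where
    d = e (class 0ℤ) i
    regroup : ∀ r x m → 1ℤ + r + (x + 0ℤ) * m ≡ 1ℤ + (r + x * m)
    regroup = solve-∀
    next : toℕ (i ⊕ 1ℤ) ≡ suc (toℕ i)
    next = trans (cong (toℕ ∘ class) (ℤ.+-comm (+ toℕ i) 1ℤ)) (toℕ-class-< 1+i<n)
    next≢0 : i ⊕ 1ℤ ≢ class 0ℤ
    next≢0 eq with trans (sym next) (trans (cong toℕ eq) (toℕ-class-< (ℕ.<-trans ℕ.z<s 1<n)))
    ... | ()
  -- The residue drops from n - 1 to 0, and the `e` term of the new residue makes up for the lost n.
  ... | inj₂ 1+i≡n = sym (begin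
    pt (i ⊕ 1ℤ) (a + d)
      ≡⟨ pt-def (i ⊕ 1ℤ) (a + d) ⟩
    + toℕ (i ⊕ 1ℤ) + (a + d + e (class 0ℤ) (i ⊕ 1ℤ)) * + n
      ≡⟨ cong (λ j → + toℕ j + (a + d + e (class 0ℤ) j) * + n) next ⟩
    + toℕ (class 0ℤ) + (a + d + e (class 0ℤ) (class 0ℤ)) * + n
      ≡⟨ cong₂ (λ r d′ → + r + (a + d + d′) * + n) (toℕ-class-< (ℕ.<-trans ℕ.z<s 1<n)) (e-≡ (class 0ℤ)) ⟩
    0ℤ + (a + d + 1ℤ) * + n
      ≡⟨ regroup (a + d) (+ n) ⟩
    + n + (a + d) * + n
      ≡⟨ cong (λ m → + m + (a + d) * + n) 1+i≡n ⟨
    1ℤ + + toℕ i + (a + d) * + n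
      ≡⟨ ℤ.+-assoc 1ℤ (+ toℕ i) ((a + d) * + n) ⟩
    1ℤ + (+ toℕ i + (a + d) * + n)
      ≡⟨ cong ℤ.suc (pt-def i a) ⟨
    ℤ.suc (pt i a)
      ∎)
    where
    d = e (class 0ℤ) i
    regroup : ∀ x m → 0ℤ + (x + 1ℤ) * m ≡ m + x * m
    regroup = solve-∀
    next : i ⊕ 1ℤ ≡ class 0ℤ
    next = trans (cong class (trans (ℤ.+-comm (+ toℕ i) 1ℤ) (cong +_ 1+i≡n))) class-n

  level-pt : ∀ i a → level (pt i a) ≡ a
  level-pt i a = pt-injectiveʳ i (begin
    pt i (level (pt i a))                     ≡⟨ cong (λ j → pt j (level (pt i a))) (class-pt i a) ⟨
    pt (class (pt i a)) (level (pt i a))      ≡⟨ pt-class-level (pt i a) ⟩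
    pt i a                                    ∎)

  -- The action by affine permutations of ℤ, under which sⱼ exchanges x and
  -- x + 1 for all x of class j.
  opaque
    act : W̃ → ℤ → ℤ
    act u x = pt (perm u ⟨$⟩ʳ class x) (level x + vec u (perm u ⟨$⟩ʳ class x))

    act-def : ∀ u x → act u x ≡ pt (perm u ⟨$⟩ʳ class x) (level x + vec u (perm u ⟨$⟩ʳ class x))
    act-def u x = refl

  act-pt : ∀ u i a → act u (pt i a) ≡ pt (perm u ⟨$⟩ʳ i) (a + vec u (perm u ⟨$⟩ʳ i))
  act-pt u i a = trans (act-def u (pt i a)) (cong₂ (λ k b → pt (perm u ⟨$⟩ʳ k) (b + vec u (perm u ⟨$⟩ʳ k)))
    (class-pt i a) (level-pt i a))

  act-cong : ∀ {u v} → u ≈ v → ∀ x → act u x ≡ act v x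
  act-cong {u} {v} u≈v x = trans (act-def u x)
    (trans (cong₂ (λ i b → pt i (level x + b)) p (trans (cong (vec u) p) (vec≈ u≈v _)))
           (sym (act-def v x)))
    where p = perm≈ u≈v (class x)

  -- The action does not see `sim`, which is compared separately. The images of window 0 suffice:
  -- their residues give `perm`, their windows `vec`.
  act-faithful : ∀ {u v} → sim u ≡ sim v → (∀ x → act u x ≡ act v x) → u ≈ v
  act-faithful {u} {v} sim≡ act≡ = mk≈ vec≡ sim≡ perm≡
    where
    at : ∀ i → pt (perm u ⟨$⟩ʳ i) (0ℤ + vec u (perm u ⟨$⟩ʳ i)) ≡
               pt (perm v ⟨$⟩ʳ i) (0ℤ + vec v (perm v ⟨$⟩ʳ i))
    at i = trans (sym (act-pt u i 0ℤ)) (trans (act≡ _) (act-pt v i 0ℤ))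
    perm≡ : ∀ i → perm u ⟨$⟩ʳ i ≡ perm v ⟨$⟩ʳ i
    perm≡ i = trans (sym (class-pt _ _)) (trans (cong class (at i)) (class-pt _ _))
    image : ∀ i → vec u (perm u ⟨$⟩ʳ i) ≡ vec v (perm u ⟨$⟩ʳ i)
    image i = +-cancelˡ 0ℤ _ _ (pt-injectiveʳ (perm u ⟨$⟩ʳ i) (trans (at i)
      (cong (λ j → pt j (0ℤ + vec v j)) (sym (perm≡ i)))))
    vec≡ : ∀ k → vec u k ≡ vec v k
    vec≡ k = subst (λ j → vec u j ≡ vec v j) (Perm.inverseʳ (perm u)) (image (perm u ⟨$⟩ˡ k))

  act-∙ : ∀ u v x → act (u ∙ v) x ≡ act u (act v x)
  act-∙ u v x = begin
    act (u ∙ v) x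
      ≡⟨ act-def (u ∙ v) x ⟩
    pt k (level x + (vec u k + vec v (perm u ⟨$⟩ˡ k)))
      ≡⟨ cong (λ j → pt k (level x + (vec u k + vec v j))) (Perm.inverseˡ (perm u)) ⟩
    pt k (level x + (vec u k + vec v j))
      ≡⟨ cong (pt k) (regroup (level x) (vec u k) (vec v j)) ⟩
    pt k (level x + vec v j + vec u k)
      ≡⟨ act-pt u j (level x + vec v j) ⟨
    act u (pt j (level x + vec v j))
      ≡⟨ cong (act u) (act-def v x) ⟨
    act u (act v x)
      ∎
    where
    j = perm v ⟨$⟩ʳ class x
    k = perm u ⟨$⟩ʳ j
    regroup : ∀ a b c → a + (b + c) ≡ a + c + b
    regroup = solve-∀

  act-𝟙 : ∀ x → act 𝟙 x ≡ x
  act-𝟙 x = trans (act-def 𝟙 x) (trans (cong (pt (class x)) (ℤ.+-identityʳ (level x))) (pt-class-level x))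

  act-⁻¹ˡ : ∀ u x → act (u ⁻¹) (act u x) ≡ x
  act-⁻¹ˡ u x = trans (sym (act-∙ (u ⁻¹) u x)) (trans (act-cong (inverseˡ u) x) (act-𝟙 x))
    where open Group W̃-group using (inverseˡ)

  act-⁻¹ʳ : ∀ u x → act u (act (u ⁻¹) x) ≡ x
  act-⁻¹ʳ u x = trans (sym (act-∙ u (u ⁻¹) x)) (trans (act-cong (inverseʳ u) x) (act-𝟙 x))
    where open Group W̃-group using (inverseʳ)

  act-injective : ∀ u {x y} → act u x ≡ act u y → x ≡ y
  act-injective u eq = trans (sym (act-⁻¹ˡ u _)) (trans (cong (act (u ⁻¹)) eq) (act-⁻¹ˡ u _))


  act-shift : ∀ u x k → act u (x + k * + n) ≡ act u x + k * + n
  act-shift u x k = begin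
    act u (x + k * + n)                        ≡⟨ cong (λ y → act u (y + k * + n)) (pt-class-level x) ⟨
    act u (pt (class x) (level x) + k * + n)   ≡⟨ cong (act u) (pt-shift (class x) (level x) k) ⟨
    act u (pt (class x) (level x + k))         ≡⟨ act-pt u (class x) (level x + k) ⟩
    pt j (level x + k + vec u j)               ≡⟨ cong (pt j) (regroup (level x) k (vec u j)) ⟩
    pt j (level x + vec u j + k)               ≡⟨ pt-shift j (level x + vec u j) k ⟩
    pt j (level x + vec u j) + k * + n
                                               ≡⟨ cong (_+ k * + n) (act-def u x) ⟨
    act u x + k * + n                          ∎
    where
    j = perm u ⟨$⟩ʳ class x
    regroup : ∀ a b c → a + b + c ≡ a + c + b
    regroup = solve-∀

  -- Only s₀ has a translation part. It accounts for the change of window between the residues 0 and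
  -- 1, which is the `e` term of `suc-pt`.
  vec-s-target : ∀ j → vec (s j) (j ⊕ 1ℤ) ≡ e (class 0ℤ) j
  vec-s-target j with j ≟ class 0ℤ
  ... | no  _    = refl
  ... | yes refl = begin
    e (class 1ℤ) (class 0ℤ ⊕ 1ℤ) - e (class (+ n)) (class 0ℤ ⊕ 1ℤ)
      ≡⟨ cong₂ (λ i k → e (class 1ℤ) i - e k i) (class-⊕ 0ℤ 1ℤ) class-n ⟩
    e (class 1ℤ) (class 1ℤ) - e (class 0ℤ) (class 1ℤ)
      ≡⟨ cong₂ _-_ (e-≡ (class 1ℤ)) (e-≢ (⊕1-≢ (class 0ℤ) ∘ trans (class-⊕ 0ℤ 1ℤ))) ⟩
    1ℤ ∎

  vec-s-source : ∀ j → vec (s j) j ≡ - e (class 0ℤ) j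
  vec-s-source j with j ≟ class 0ℤ
  ... | no  _    = refl
  ... | yes refl = begin
    e (class 1ℤ) (class 0ℤ) - e (class (+ n)) (class 0ℤ)
      ≡⟨ cong (λ k → e (class 1ℤ) (class 0ℤ) - e k (class 0ℤ)) class-n ⟩
    e (class 1ℤ) (class 0ℤ) - e (class 0ℤ) (class 0ℤ)
      ≡⟨ cong₂ _-_ (e-≢ (⊕1-≢ (class 0ℤ) ∘ trans (class-⊕ 0ℤ 1ℤ) ∘ sym)) (e-≡ (class 0ℤ)) ⟩
    - 1ℤ ∎

  vec-s-other : ∀ {j k} → k ≢ j → k ≢ j ⊕ 1ℤ → vec (s j) k ≡ 0ℤ
  vec-s-other {j} {k} k≢j k≢j+1 with j ≟ class 0ℤ
  ... | no  _    = refl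
  ... | yes refl = cong₂ _-_ (e-≢ (k≢j+1 ∘ (λ p → trans p (sym (class-⊕ 0ℤ 1ℤ)))))
                             (e-≢ (k≢j ∘ (λ p → trans p class-n)))

  perm-s-source : ∀ j → perm (s j) ⟨$⟩ʳ j ≡ j ⊕ 1ℤ
  perm-s-source j rewrite dec-true (j ≟ j) refl = refl

  perm-s-target : ∀ j → perm (s j) ⟨$⟩ʳ (j ⊕ 1ℤ) ≡ j
  perm-s-target j rewrite dec-false (j ⊕ 1ℤ ≟ j) (⊕1-≢ j) | dec-true (j ⊕ 1ℤ ≟ j ⊕ 1ℤ) refl = refl

  perm-s-other : ∀ {j k} → k ≢ j → k ≢ j ⊕ 1ℤ → perm (s j) ⟨$⟩ʳ k ≡ k
  perm-s-other {j} {k} k≢j k≢j+1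
    rewrite dec-false (k ≟ j) k≢j | dec-false (k ≟ j ⊕ 1ℤ) k≢j+1 = refl

  act-s-up : ∀ x → act (s (class x)) x ≡ ℤ.suc x
  act-s-up x = begin
    act (s j) x
      ≡⟨ act-def (s j) x ⟩
    pt (perm (s j) ⟨$⟩ʳ j) (level x + vec (s j) (perm (s j) ⟨$⟩ʳ j))
      ≡⟨ cong (λ k → pt k (level x + vec (s j) k)) (perm-s-source j) ⟩
    pt (j ⊕ 1ℤ) (level x + vec (s j) (j ⊕ 1ℤ))
      ≡⟨ cong (λ b → pt (j ⊕ 1ℤ) (level x + b)) (vec-s-target j) ⟩
    pt (j ⊕ 1ℤ) (level x + e (class 0ℤ) j)
      ≡⟨ suc-pt j (level x) ⟨
    ℤ.suc (pt j (level x))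
      ≡⟨ cong ℤ.suc (pt-class-level x) ⟩
    ℤ.suc x ∎
    where j = class x

  act-s-down : ∀ x → act (s (class x)) (ℤ.suc x) ≡ x
  act-s-down x = begin
    act (s j) (ℤ.suc x)
      ≡⟨ cong (act (s j) ∘ ℤ.suc) (pt-class-level x) ⟨
    act (s j) (ℤ.suc (pt j (level x)))
      ≡⟨ cong (act (s j)) (suc-pt j (level x)) ⟩
    act (s j) (pt (j ⊕ 1ℤ) (level x + d))
      ≡⟨ act-pt (s j) (j ⊕ 1ℤ) (level x + d) ⟩
    pt (perm (s j) ⟨$⟩ʳ (j ⊕ 1ℤ)) (level x + d + vec (s j) (perm (s j) ⟨$⟩ʳ (j ⊕ 1ℤ)))
      ≡⟨ cong (λ k → pt k (level x + d + vec (s j) k)) (perm-s-target j) ⟩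
    pt j (level x + d + vec (s j) j)
      ≡⟨ cong (λ b → pt j (level x + d + b)) (vec-s-source j) ⟩
    pt j (level x + d - d)
      ≡⟨ cong (pt j) (cancel (level x) d) ⟩
    pt j (level x)
      ≡⟨ pt-class-level x ⟩
    x ∎
    where
    j = class x
    d = e (class 0ℤ) j
    cancel : ∀ a b → a + b - b ≡ a
    cancel = solve-∀

  act-s-fix : ∀ {j} x → class x ≢ j → class x ≢ j ⊕ 1ℤ → act (s j) x ≡ x
  act-s-fix {j} x x≢j x≢j+1 = begin
    act (s j) x
      ≡⟨ act-def (s j) x ⟩
    pt (perm (s j) ⟨$⟩ʳ class x) (level x + vec (s j) (perm (s j) ⟨$⟩ʳ class x))
      ≡⟨ cong (λ k → pt k (level x + vec (s j) k)) (perm-s-other x≢j x≢j+1) ⟩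
    pt (class x) (level x + vec (s j) (class x))
      ≡⟨ cong (λ b → pt (class x) (level x + b)) (vec-s-other x≢j x≢j+1) ⟩
    pt (class x) (level x + 0ℤ)
      ≡⟨ cong (pt (class x)) (ℤ.+-identityʳ (level x)) ⟩
    pt (class x) (level x)
      ≡⟨ pt-class-level x ⟩
    x ∎

  -- The value of `s j` is stored with each case, and `down` is indexed by a successor, so that
  -- matching on it leaves no predecessors to simplify.
  data Position (j : ℤ/n) : ℤ → Set where
    up   : ∀ {x} → class x ≡ j → act (s j) x ≡ ℤ.suc x → Position j x
    down : ∀ y → class y ≡ j → act (s j) (ℤ.suc y) ≡ y → Position j (ℤ.suc y)
    off  : ∀ {x} → class x ≢ j → class x ≢ j ⊕ 1ℤ → act (s j) x ≡ x → Position j x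

  position : ∀ j x → Position j x
  position j x with class x ≟ j
  ... | yes refl = up refl (act-s-up x)
  ... | no x≢j with class x ≟ j ⊕ 1ℤ
  ...   | no x≢j+1 = off x≢j x≢j+1 (act-s-fix x x≢j x≢j+1)
  ...   | yes x≡j+1 = subst (Position j) (ℤ.suc-pred x)
          (down (ℤ.pred x) p (subst (λ i → act (s i) (ℤ.suc (ℤ.pred x)) ≡ ℤ.pred x) p (act-s-down _)))
    where
    p : class (ℤ.pred x) ≡ j
    p = begin
      class (ℤ.pred x)                 ≡⟨ cong class (ℤ.+-comm (- 1ℤ) x) ⟩
      class (x + - 1ℤ)                 ≡⟨ class-⊕ x (- 1ℤ) ⟨
      class x ⊕ - 1ℤ                   ≡⟨ cong (_⊕ - 1ℤ) x≡j+1 ⟩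
      j ⊕ 1ℤ ⊕ - 1ℤ                    ≡⟨ ⊕-inverse 1ℤ j ⟩
      j                                ∎


  -- The cycle lowers the residue by one; the successor on the left restores it, so that `suc-pt`
  -- gives the window.
  act-τ₀ : ∀ x → ℤ.suc (act τ₀ x) ≡ x + + n
  act-τ₀ x = begin
    ℤ.suc (act τ₀ x)
      ≡⟨ cong ℤ.suc (act-def τ₀ x) ⟩
    ℤ.suc (pt j (level x + (1ℤ - e (class (+ n)) j)))
      ≡⟨ suc-pt j (level x + (1ℤ - e (class (+ n)) j)) ⟩
    pt (j ⊕ 1ℤ) (level x + (1ℤ - e (class (+ n)) j) + e (class 0ℤ) j)
      ≡⟨ cong₂ (λ i k → pt i (level x + (1ℤ - e k j) + e (class 0ℤ) j)) (⊕-inverse (- 1ℤ) (class x)) class-n ⟩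
    pt (class x) (level x + (1ℤ - e (class 0ℤ) j) + e (class 0ℤ) j)
      ≡⟨ cong (pt (class x)) (cancel (level x) (e (class 0ℤ) j)) ⟩
    pt (class x) (level x + 1ℤ)
      ≡⟨ pt-shift (class x) (level x) 1ℤ ⟩
    pt (class x) (level x) + 1ℤ * + n
      ≡⟨ cong₂ _+_ (pt-class-level x) (ℤ.*-identityˡ (+ n)) ⟩
    x + + n ∎
    where
    j = class x ⊕ - 1ℤ
    cancel : ∀ a b → a + (1ℤ - b) + b ≡ a + 1ℤ
    cancel = solve-∀

  act-ζ : ∀ x → act ζ x ≡ x + + n
  act-ζ x = trans (trans (act-def ζ x) (pt-shift (class x) (level x) 1ℤ))
    (cong₂ _+_ (pt-class-level x) (ℤ.*-identityˡ (+ n)))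

  act-translation : ∀ j x → act (t⟨ 1-e j ⨾ 1ℤ ⟩ Perm.id) x ≡ x + (1ℤ - e j (class x)) * + n
  act-translation j x = trans
    (trans (act-def (t⟨ 1-e j ⨾ 1ℤ ⟩ Perm.id) x) (pt-shift (class x) (level x) (1ℤ - e j (class x))))
    (cong (_+ (1ℤ - e j (class x)) * + n) (pt-class-level x))

-- Degree, products of simple reflections, and the strong exchange property.

module Words (n : ℕ) .{{_ : NonTrivial n}} where
  open IwahoriWeyl n
  open AffineAction n
  open Group W̃-group
    using (setoid; assoc; ∙-cong; identityˡ; identityʳ; inverseˡ; inverseʳ)
    renaming (refl to ≈-refl; sym to ≈-sym; trans to ≈-trans) public
  open import Algebra.Properties.Group W̃-group using (⁻¹-anti-homo-∙; ⁻¹-involutive) renaming (∙-cancelʳ to W̃-cancelʳ) public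
  module ≈-Reasoning = SetoidReasoning setoid

  -- Products of elements of W̃ unfold to records, so that their factors
  -- cannot be inferred.
  ∙-congˡ : ∀ u {v v′} → v ≈ v′ → u ∙ v ≈ u ∙ v′
  ∙-congˡ u {v} {v′} = ∙-cong {u} {u} {v} {v′} (≈-refl {u})

  ∙-congʳ : ∀ u {v v′} → v ≈ v′ → v ∙ u ≈ v′ ∙ u
  ∙-congʳ u {v} {v′} p = ∙-cong {v} {v′} {u} {u} p (≈-refl {u})

  ≈-∙-trans : ∀ u v v′ t → u ≈ v ∙ t → v ≈ v′ → u ≈ v′ ∙ t
  ≈-∙-trans u v v′ t p q = ≈-trans p (∙-congʳ t q)

  deg : W̃ → ℤ
  deg u = sum (vec u)

  deg-cong : ∀ {u v} → u ≈ v → deg u ≡ deg v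
  deg-cong u≈v = sum-cong-≗ (vec≈ u≈v)

  deg-∙ : ∀ u v → deg (u ∙ v) ≡ deg u + deg v
  deg-∙ u v = trans (∑-distrib-+ (vec u) (λ i → vec v (perm u ⟨$⟩ˡ i)))
    (cong (λ d → deg u + d) (sym (sum-permute (vec v) (Perm.flip (perm u)))))

  deg-𝟙 : deg 𝟙 ≡ 0ℤ
  deg-𝟙 = sum-replicate-zero n

  deg-⁻¹ : ∀ u → deg (u ⁻¹) ≡ - deg u
  deg-⁻¹ u = +-cancelʳ (deg u) _ _
    (trans (sym (deg-∙ (u ⁻¹) u)) (trans (deg-cong (inverseˡ u)) (trans deg-𝟙 (sym (ℤ.+-inverseˡ (deg u))))))

  private
    sum-e : ∀ {m} (j : Fin m) → sum (λ i → if does (i ≟ j) then 1ℤ else 0ℤ) ≡ 1ℤ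
    sum-e {suc m} zero    = cong (λ x → 1ℤ + x) (sum-replicate-zero m)
    sum-e {suc m} (suc j) = trans (ℤ.+-identityˡ _) (sum-e j)

    sum-1 : ∀ m → sum {m} (λ _ → 1ℤ) ≡ + m
    sum-1 ℕ.zero  = refl
    sum-1 (suc m) = cong ℤ.suc (sum-1 m)

    sum-minus : ∀ {m} (f g : Vector ℤ m) → sum (λ i → f i - g i) ≡ sum f - sum g
    sum-minus f g = +-cancelʳ (sum g) _ _ (trans (sym (∑-distrib-+ _ g))
      (trans (sum-cong-≗ (λ i → cancel (f i) (g i))) (sym (cancel (sum f) (sum g)))))
      where
      cancel : ∀ a b → a - b + b ≡ a
      cancel = solve-∀

  deg-s : ∀ j → deg (s j) ≡ 0ℤ
  deg-s j with j ≟ class 0ℤ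
  ... | no  _ = sum-replicate-zero n
  ... | yes _ = trans (sum-minus (e (class 1ℤ)) (e (class (+ n))))
                      (cong₂ _-_ (sum-e (class 1ℤ)) (sum-e (class (+ n))))

  deg-τ₀ : deg τ₀ ≡ + n - 1ℤ
  deg-τ₀ = trans (sum-minus (λ _ → 1ℤ) (e (class (+ n)))) (cong₂ _-_ (sum-1 n) (sum-e (class (+ n))))

  s-Wₐ : ∀ j → Wₐ (s j)
  s-Wₐ j = deg-s j , refl

  ∙-Wₐ : ∀ {u v} → Wₐ u → Wₐ v → Wₐ (u ∙ v)
  ∙-Wₐ {u} {v} (p , q) (p′ , q′) = trans (deg-∙ u v) (cong₂ _+_ p p′) , cong₂ _+_ q q′

  ⁻¹-Wₐ : ∀ {u} → Wₐ u → Wₐ (u ⁻¹)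
  ⁻¹-Wₐ {u} (p , q) = trans (deg-⁻¹ u) (cong -_ p) , cong -_ q

  opaque
    ∏s : List ℤ/n → W̃
    ∏s xs = ∏ (map s xs)

    ∏s-def : ∀ xs → ∏s xs ≡ ∏ (map s xs)
    ∏s-def xs = refl

    ∏s-[] : ∏s [] ≡ 𝟙
    ∏s-[] = refl

    ∏s-∷ : ∀ x xs → ∏s (x ∷ xs) ≡ s x ∙ ∏s xs
    ∏s-∷ x xs = refl

  ≡⇒≈ : ∀ {u v} → u ≡ v → u ≈ v
  ≡⇒≈ {u} refl = ≈-refl {u}

  ∏s-≈ : ∀ xs → ∏s xs ≈ ∏ (map s xs)
  ∏s-≈ xs = ≡⇒≈ (∏s-def xs)

  act-∏s-[] : ∀ z → act (∏s []) z ≡ z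
  act-∏s-[] z = trans (cong (λ u → act u z) ∏s-[]) (act-𝟙 z)

  act-∏s-∷ : ∀ x xs z → act (∏s (x ∷ xs)) z ≡ act (s x) (act (∏s xs) z)
  act-∏s-∷ x xs z = trans (cong (λ u → act u z) (∏s-∷ x xs)) (act-∙ (s x) (∏s xs) z)

  ∏s-Wₐ : ∀ xs → Wₐ (∏s xs)
  ∏s-Wₐ []       = subst Wₐ (sym ∏s-[]) (deg-𝟙 , refl)
  ∏s-Wₐ (x ∷ xs) = subst Wₐ (sym (∏s-∷ x xs)) (∙-Wₐ {s x} {∏s xs} (s-Wₐ x) (∏s-Wₐ xs))

  ∏s-++ : ∀ xs ys → ∏s (xs ++ ys) ≈ ∏s xs ∙ ∏s ys
  ∏s-++ []       ys = ≈-trans (≈-sym (identityˡ (∏s ys))) (∙-congʳ (∏s ys) (≡⇒≈ (sym ∏s-[])))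
  ∏s-++ (x ∷ xs) ys = begin
    ∏s (x ∷ xs ++ ys)        ≈⟨ ≡⇒≈ (∏s-∷ x (xs ++ ys)) ⟩
    s x ∙ ∏s (xs ++ ys)      ≈⟨ ∙-congˡ (s x) (∏s-++ xs ys) ⟩
    s x ∙ (∏s xs ∙ ∏s ys)    ≈⟨ assoc (s x) (∏s xs) (∏s ys) ⟨
    s x ∙ ∏s xs ∙ ∏s ys      ≈⟨ ∙-congʳ (∏s ys) (≡⇒≈ (∏s-∷ x xs)) ⟨
    ∏s (x ∷ xs) ∙ ∏s ys      ∎
    where open ≈-Reasoning

  act-τ₀-deg : ∀ x → act τ₀ x ≡ x + (+ n - 1ℤ)
  act-τ₀-deg x = +-cancelˡ 1ℤ _ _ (trans (act-τ₀ x) (regroup x (+ n)))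
    where
    regroup : ∀ x m → x + m ≡ 1ℤ + (x + (m - 1ℤ))
    regroup = solve-∀

  -- The degrees n - 1 of τ₀ and n of ζ are their displacements, and both degree and displacement
  -- are additive.
  act-Ω : ∀ {ω} → Ω ω → ∀ x → act ω x ≡ x + deg ω
  act-Ω (gen gen-τ₀) x = trans (act-τ₀-deg x) (cong (λ d → x + d) (sym deg-τ₀))
  act-Ω (gen gen-ζ)  x = trans (act-ζ x) (cong (λ d → x + d) (sym (sum-1 n)))
  act-Ω unit         x = trans (act-𝟙 x) (trans (sym (ℤ.+-identityʳ x)) (cong (λ d → x + d) (sym deg-𝟙)))
  act-Ω (mul {g} {h} p q) x = trans (act-∙ g h x) (trans (act-Ω p (act h x))
    (trans (cong (_+ deg g) (act-Ω q x)) (trans (regroup x (deg g) (deg h)) (cong (λ d → x + d) (sym (deg-∙ g h))))))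
    where
    regroup : ∀ x a b → x + b + a ≡ x + (a + b)
    regroup = solve-∀
  act-Ω (inv {g} p) x = +-cancelʳ (deg g) _ _ (trans (sym (act-Ω p (act (g ⁻¹) x)))
    (trans (act-⁻¹ʳ g x) (sym (trans (cong (λ d → x + d + deg g) (deg-⁻¹ g)) (cancel x (deg g))))))
    where
    cancel : ∀ x a → x + (- a) + a ≡ x
    cancel = solve-∀
  act-Ω (resp {g} {h} g≈h p) x = trans (sym (act-cong g≈h x)) (trans (act-Ω p x) (cong (λ d → x + d) (deg-cong g≈h)))

  -- Both `deg` and `sim` vanish on Wₐ, and together they determine an element of Ω, which acts as
  -- translation by its degree.
  Ω-unique : ∀ {w w′ ω ω′} → Wₐ w → Wₐ w′ → Ω ω → Ω ω′ → w ∙ ω ≈ w′ ∙ ω′ → ω ≈ ω′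
  Ω-unique {w} {w′} {ω} {ω′} (dw , sw) (dw′ , sw′) pω pω′ eq = act-faithful
    (trans (part (sim w) (sim ω) sw) (trans (sim≈ eq) (sym (part (sim w′) (sim ω′) sw′))))
    (λ x → trans (act-Ω pω x) (trans (cong (λ d → x + d) deg≡) (sym (act-Ω pω′ x))))
    where
    part : ∀ a b → a ≡ 0ℤ → b ≡ a + b
    part a b refl = sym (ℤ.+-identityˡ b)
    deg≡ : deg ω ≡ deg ω′
    deg≡ = trans (trans (part (deg w) (deg ω) dw) (sym (deg-∙ w ω)))
             (trans (deg-cong eq) (trans (deg-∙ w′ ω′) (sym (part (deg w′) (deg ω′) dw′))))

  Wₐ-unique : ∀ {w w′ ω ω′} → Wₐ w → Wₐ w′ → Ω ω → Ω ω′ → w ∙ ω ≈ w′ ∙ ω′ → w ≈ w′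
  Wₐ-unique {w} {w′} {ω} {ω′} pw pw′ pω pω′ eq = W̃-cancelʳ ω w w′
    (≈-trans eq (∙-congˡ w′ (≈-sym (Ω-unique {w} {w′} {ω} {ω′} pw pw′ pω pω′ eq))))

  -- Conjugation by h turns the exchange of the translates of x and x + 1 into the exchange of their
  -- images. The commutation rules below and the deletion of a letter in `exchange` are instances.
  conj-s : ∀ h x y → act h x ≡ y → act h (ℤ.suc x) ≡ ℤ.suc y → h ∙ s (class x) ≈ s (class y) ∙ h
  conj-s h x y hx hx′ = act-faithful (trans (ℤ.+-identityʳ (sim h)) (sym (ℤ.+-identityˡ (sim h))))
    (λ z → trans (act-∙ h (s (class x)) z) (trans (main z (position (class x) z)) (sym (act-∙ (s (class y)) h z))))
    where
    open ≡-Reasoning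
    suc-shift : ∀ a k → ℤ.suc (a + k * + n) ≡ ℤ.suc a + k * + n
    suc-shift a k = sym (ℤ.+-assoc 1ℤ a (k * + n))
    lower : ∀ z k → z ≡ x + k * + n → act h z ≡ y + k * + n
    lower _ k refl = trans (act-shift h x k) (cong (_+ k * + n) hx)
    upper : ∀ z k → z ≡ x + k * + n → act h (ℤ.suc z) ≡ ℤ.suc (act h z)
    upper z k eq = begin
      act h (ℤ.suc z)               ≡⟨ cong (act h ∘ ℤ.suc) eq ⟩
      act h (ℤ.suc (x + k * + n))   ≡⟨ cong (act h) (suc-shift x k) ⟩
      act h (ℤ.suc x + k * + n)     ≡⟨ act-shift h (ℤ.suc x) k ⟩
      act h (ℤ.suc x) + k * + n     ≡⟨ cong (_+ k * + n) hx′ ⟩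
      ℤ.suc y + k * + n             ≡⟨ suc-shift y k ⟨
      ℤ.suc (y + k * + n)           ≡⟨ cong ℤ.suc (lower z k eq) ⟨
      ℤ.suc (act h z)               ∎
    class-y : ∀ z k → z ≡ x + k * + n → class (act h z) ≡ class y
    class-y z k eq = trans (cong class (lower z k eq)) (class-shift y k)
    reflect : ∀ b k → act h b ≡ y + k * + n → b ≡ x + k * + n
    reflect b k eq = act-injective h {b} {x + k * + n} (trans eq (sym (lower (x + k * + n) k refl)))
    main : ∀ z → Position (class x) z → act h (act (s (class x)) z) ≡ act (s (class y)) (act h z)
    main z (up c eq) with class-injective z x c
    ... | k , z≡ = begin
      act h (act (s (class x)) z)          ≡⟨ cong (act h) eq ⟩
      act h (ℤ.suc z)                      ≡⟨ upper z k z≡ ⟩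
      ℤ.suc (act h z)                      ≡⟨ act-s-up (act h z) ⟨
      act (s (class (act h z))) (act h z)  ≡⟨ cong (λ i → act (s i) (act h z)) (class-y z k z≡) ⟩
      act (s (class y)) (act h z)          ∎
    main _ (down z c eq) with class-injective z x c
    ... | k , z≡ = begin
      act h (act (s (class x)) (ℤ.suc z))          ≡⟨ cong (act h) eq ⟩
      act h z                                      ≡⟨ act-s-down (act h z) ⟨
      act (s (class (act h z))) (ℤ.suc (act h z))  ≡⟨ cong₂ (λ i → act (s i)) (class-y z k z≡) (sym (upper z k z≡)) ⟩
      act (s (class y)) (act h (ℤ.suc z))          ∎
    main z (off c c′ eq) = trans (cong (act h) eq) (sym (act-s-fix (act h z) off₁ off₂))
      where
      off₁ : class (act h z) ≢ class y
      off₁ p with class-injective (act h z) y p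
      ... | k , q = c (trans (cong class (reflect z k q)) (class-shift x k))
      off₂ : class (act h z) ≢ class y ⊕ 1ℤ
      off₂ p with class-injective (act h z) (ℤ.suc y) (trans p (sym (class-suc y)))
      ... | k , q = c′ (trans (cong class z≡) (trans (class-shift (ℤ.suc x) k) (class-suc x)))
        where
        z≡ : z ≡ ℤ.suc x + k * + n
        z≡ = act-injective h (trans q (sym (trans (act-shift h (ℤ.suc x) k) (cong (_+ k * + n) hx′))))

  s-commute : ∀ {i j} → i ≢ j → i ≢ j ⊕ 1ℤ → j ≢ i ⊕ 1ℤ → s i ∙ s j ≈ s j ∙ s i
  s-commute {i} {j} i≢j i≢j+1 j≢i+1 =
    subst (λ k → s i ∙ s k ≈ s k ∙ s i) (class-toℕ j) (conj-s (s i) x x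
      (act-s-fix x (λ p → i≢j (trans (sym p) x≡j)) (λ p → j≢i+1 (trans (sym x≡j) p)))
      (act-s-fix (ℤ.suc x) (λ p → i≢j+1 (trans (sym p) 1+x≡j+1))
                           (λ p → i≢j (⊕1-injective (trans (sym p) 1+x≡j+1)))))
    where
    x = + toℕ j
    x≡j : class x ≡ j
    x≡j = class-toℕ j
    1+x≡j+1 : class (ℤ.suc x) ≡ j ⊕ 1ℤ
    1+x≡j+1 = trans (class-suc x) (cong (_⊕ 1ℤ) x≡j)

  s-cong : ∀ {i j} → i ≡ j → s i ≈ s j
  s-cong {i} refl = ≈-refl {s i}

  -- For a lift a of i, the translation t sends a + 1 to a + n, which is again of class i, so
  -- `conj-s` applies.
  s-shift : ∀ t → (∀ x → act t x ≡ x + (+ n - 1ℤ)) → ∀ i → s i ∙ t ≈ t ∙ s (i ⊕ 1ℤ)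
  s-shift t act-t i = lift (+ toℕ i) (class-toℕ i)
    where
    open ≈-Reasoning
    shift₀ : ∀ a m → 1ℤ + a + (m - 1ℤ) ≡ a + 1ℤ * m
    shift₀ = solve-∀
    shift₁ : ∀ a m → 1ℤ + (1ℤ + a) + (m - 1ℤ) ≡ 1ℤ + (a + 1ℤ * m)
    shift₁ = solve-∀
    lift : ∀ a → class a ≡ i → s i ∙ t ≈ t ∙ s (i ⊕ 1ℤ)
    lift a a≡i = begin
      s i ∙ t                       ≈⟨ ∙-congʳ t (s-cong (sym (trans (class-shift a 1ℤ) a≡i))) ⟩
      s (class (a + 1ℤ * + n)) ∙ t  ≈⟨ conj-s t (ℤ.suc a) (a + 1ℤ * + n)
                                         (trans (act-t (ℤ.suc a)) (shift₀ a (+ n)))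
                                         (trans (act-t (ℤ.suc (ℤ.suc a))) (shift₁ a (+ n))) ⟨
      t ∙ s (class (ℤ.suc a))       ≈⟨ ∙-congˡ t (s-cong (trans (class-suc a) (cong (_⊕ 1ℤ) a≡i))) ⟩
      t ∙ s (i ⊕ 1ℤ)                ∎

  -- The unfolding of τ₀ contains proofs that are expensive to compare.
  opaque
    τ : W̃
    τ = τ₀

    τ≈τ₀ : τ ≈ τ₀
    τ≈τ₀ = ≈-refl {τ₀}

  τ-Ω : Ω τ
  τ-Ω = resp (≈-sym τ≈τ₀) (gen gen-τ₀)

  deg-τ : deg τ ≡ + n - 1ℤ
  deg-τ = trans (deg-cong τ≈τ₀) deg-τ₀

  act-τ : ∀ x → act τ x ≡ x + (+ n - 1ℤ)
  act-τ x = trans (act-cong τ≈τ₀ x) (act-τ₀-deg x)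

  s-τ : ∀ i → s i ∙ τ ≈ τ ∙ s (i ⊕ 1ℤ)
  s-τ = s-shift τ act-τ

  s-involutive : ∀ j → s j ∙ s j ≈ 𝟙
  s-involutive j = act-faithful refl
    (λ x → trans (act-∙ (s j) (s j) x) (trans (main x (position j x)) (sym (act-𝟙 x))))
    where
    main : ∀ x → Position j x → act (s j) (act (s j) x) ≡ x
    main x (up refl eq)     = trans (cong (act (s j)) eq) (act-s-down x)
    main _ (down y refl eq) = trans (cong (act (s j)) eq) (act-s-up y)
    main x (off _ _ eq)     = trans (cong (act (s j)) eq) eq

  <1+⇒≤ : ∀ {y z} → y ℤ.< ℤ.suc z → y ℤ.≤ z
  <1+⇒≤ {y} {z} p = subst (y ℤ.≤_) (ℤ.pred-suc z) (ℤ.i<j⇒i≤pred[j] p)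

  -- A simple reflection moves every integer by at most one. To reverse y < z it has to raise y and
  -- lower z, which leaves no room between them.
  s-flip : ∀ {j y z} → y ℤ.< z → act (s j) z ℤ.< act (s j) y → class y ≡ j × z ≡ ℤ.suc y
  s-flip {j} {y} {z} y<z sz<sy = main (position j y) (position j z) y<z sz<sy
    where
    absurd : ∀ {a b} {A : Set} → a ℤ.< b → b ℤ.≤ a → A
    absurd p q = ⊥-elim (ℤ.<-irrefl refl (ℤ.<-≤-trans p q))
    main : ∀ {y z} → Position j y → Position j z → y ℤ.< z → act (s j) z ℤ.< act (s j) y → class y ≡ j × z ≡ ℤ.suc y
    main (up c p) (up _ q) y<z lt rewrite p | q = absurd y<z (ℤ.≤-trans (ℤ.i≤suc[i] _) (<1+⇒≤ lt))
    main (up c p) (down z′ _ q) y<z lt rewrite p | q = c , cong ℤ.suc (ℤ.≤-antisym (<1+⇒≤ lt) (<1+⇒≤ y<z))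
    main (up c p) (off _ _ q) y<z lt rewrite p | q = absurd y<z (<1+⇒≤ lt)
    main (down y′ _ p) (up _ q) y<z lt rewrite p | q =
      absurd y<z (ℤ.≤-trans (ℤ.i≤suc[i] _) (ℤ.≤-trans (ℤ.<⇒≤ lt) (ℤ.i≤suc[i] _)))
    main (down y′ _ p) (down z′ _ q) y<z lt rewrite p | q = absurd y<z (ℤ.suc-mono (ℤ.<⇒≤ lt))
    main (down y′ _ p) (off _ _ q) y<z lt rewrite p | q = absurd y<z (ℤ.≤-trans (ℤ.<⇒≤ lt) (ℤ.i≤suc[i] _))
    main (off _ _ p) (up _ q) y<z lt rewrite p | q = absurd y<z (ℤ.≤-trans (ℤ.i≤suc[i] _) (ℤ.<⇒≤ lt))
    main (off _ _ p) (down z′ _ q) y<z lt rewrite p | q = absurd lt (<1+⇒≤ y<z)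
    main (off _ _ p) (off _ _ q) y<z lt rewrite p | q = absurd y<z (ℤ.<⇒≤ lt)

  reflection : W̃ → ℤ → W̃
  reflection g x = g ∙ s (class x) ∙ g ⁻¹

  act-reflection-lower : ∀ g x → act (reflection g x) (act g x) ≡ act g (ℤ.suc x)
  act-reflection-lower g x = begin
    act (g ∙ s (class x) ∙ g ⁻¹) (act g x)            ≡⟨ act-∙ (g ∙ s (class x)) (g ⁻¹) (act g x) ⟩
    act (g ∙ s (class x)) (act (g ⁻¹) (act g x))      ≡⟨ cong (act (g ∙ s (class x))) (act-⁻¹ˡ g x) ⟩
    act (g ∙ s (class x)) x                           ≡⟨ act-∙ g (s (class x)) x ⟩
    act g (act (s (class x)) x)                       ≡⟨ cong (act g) (act-s-up x) ⟩
    act g (ℤ.suc x)                                   ∎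
    where open ≡-Reasoning

  act-reflection-upper : ∀ g x → act (reflection g x) (act g (ℤ.suc x)) ≡ act g x
  act-reflection-upper g x = begin
    act (g ∙ s (class x) ∙ g ⁻¹) (act g (ℤ.suc x))        ≡⟨ act-∙ (g ∙ s (class x)) (g ⁻¹) (act g (ℤ.suc x)) ⟩
    act (g ∙ s (class x)) (act (g ⁻¹) (act g (ℤ.suc x)))  ≡⟨ cong (act (g ∙ s (class x))) (act-⁻¹ˡ g (ℤ.suc x)) ⟩
    act (g ∙ s (class x)) (ℤ.suc x)                       ≡⟨ act-∙ g (s (class x)) (ℤ.suc x) ⟩
    act g (act (s (class x)) (ℤ.suc x))                   ≡⟨ cong (act g) (act-s-down x) ⟩
    act g x                                               ∎
    where open ≡-Reasoning

  cancel-s : ∀ j u → s j ∙ (s j ∙ u) ≈ u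
  cancel-s j u = ≈-trans (≈-sym (assoc (s j) (s j) u)) (≈-trans (∙-congʳ u (s-involutive j)) (identityˡ u))

  cancel-inverse : ∀ u g → u ∙ g ∙ g ⁻¹ ≈ u
  cancel-inverse u g = ≈-trans (assoc u g (g ⁻¹)) (≈-trans (∙-congˡ u (inverseʳ g)) (identityʳ u))

  reflection-involutive : ∀ g x → reflection g x ∙ reflection g x ≈ 𝟙
  reflection-involutive g x = begin
    g ∙ σ ∙ g ⁻¹ ∙ (g ∙ σ ∙ g ⁻¹)     ≈⟨ assoc (g ∙ σ) (g ⁻¹) (g ∙ σ ∙ g ⁻¹) ⟩
    g ∙ σ ∙ (g ⁻¹ ∙ (g ∙ σ ∙ g ⁻¹))   ≈⟨ ∙-congˡ (g ∙ σ) (∙-congˡ (g ⁻¹) (assoc g σ (g ⁻¹))) ⟩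
    g ∙ σ ∙ (g ⁻¹ ∙ (g ∙ (σ ∙ g ⁻¹))) ≈⟨ ∙-congˡ (g ∙ σ) (assoc (g ⁻¹) g (σ ∙ g ⁻¹)) ⟨
    g ∙ σ ∙ (g ⁻¹ ∙ g ∙ (σ ∙ g ⁻¹))   ≈⟨ ∙-congˡ (g ∙ σ) (∙-congʳ (σ ∙ g ⁻¹) (inverseˡ g)) ⟩
    g ∙ σ ∙ (𝟙 ∙ (σ ∙ g ⁻¹))          ≈⟨ ∙-congˡ (g ∙ σ) (identityˡ (σ ∙ g ⁻¹)) ⟩
    g ∙ σ ∙ (σ ∙ g ⁻¹)                ≈⟨ assoc g σ (σ ∙ g ⁻¹) ⟩
    g ∙ (σ ∙ (σ ∙ g ⁻¹))              ≈⟨ ∙-congˡ g (cancel-s (class x) (g ⁻¹)) ⟩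
    g ∙ g ⁻¹                          ≈⟨ inverseʳ g ⟩
    𝟙                                 ∎
    where
    open ≈-Reasoning
    σ = s (class x)

  -- By `conj-s` for w ∙ g, the reflection to the right of w equals a simple reflection to its left,
  -- and the two copies of the latter cancel.
  reflection-from-left : ∀ w g x → act w (act g (ℤ.suc x)) ≡ ℤ.suc (act w (act g x)) →
                         s (class (act w (act g x))) ∙ w ∙ reflection g x ≈ w
  reflection-from-left w g x next = begin
    σ′ ∙ w ∙ (g ∙ σ ∙ g ⁻¹)      ≈⟨ assoc σ′ w (g ∙ σ ∙ g ⁻¹) ⟩
    σ′ ∙ (w ∙ (g ∙ σ ∙ g ⁻¹))    ≈⟨ ∙-congˡ σ′ (assoc w (g ∙ σ) (g ⁻¹)) ⟨
    σ′ ∙ (w ∙ (g ∙ σ) ∙ g ⁻¹)    ≈⟨ ∙-congˡ σ′ (∙-congʳ (g ⁻¹) (assoc w g σ)) ⟨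
    σ′ ∙ (w ∙ g ∙ σ ∙ g ⁻¹)      ≈⟨ ∙-congˡ σ′ (∙-congʳ (g ⁻¹) (conj-s (w ∙ g) x (act w (act g x))
                                      (act-∙ w g x) (trans (act-∙ w g (ℤ.suc x)) next))) ⟩
    σ′ ∙ (σ′ ∙ (w ∙ g) ∙ g ⁻¹)   ≈⟨ ∙-congˡ σ′ (assoc σ′ (w ∙ g) (g ⁻¹)) ⟩
    σ′ ∙ (σ′ ∙ (w ∙ g ∙ g ⁻¹))   ≈⟨ cancel-s (class (act w (act g x))) (w ∙ g ∙ g ⁻¹) ⟩
    w ∙ g ∙ g ⁻¹                 ≈⟨ cancel-inverse w g ⟩
    w                            ∎
    where
    open ≈-Reasoning
    σ = s (class x)
    σ′ = s (class (act w (act g x)))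

  -- Following p and q through the letters of xs from the right, their order
  -- is reversed by some letter; that letter exchanges their current images, so
  -- it is the one that the reflection deletes.
  exchange : ∀ xs g x → act g x ℤ.< act g (ℤ.suc x) →
             act (∏s xs) (act g (ℤ.suc x)) ℤ.< act (∏s xs) (act g x) →
             ∃[ ys ] ys ⊑ xs × suc (length ys) ≡ length xs × ∏s ys ≈ ∏s xs ∙ reflection g x
  exchange [] g x p<q wq<wp = ⊥-elim (ℤ.<-asym p<q
    (subst₂ ℤ._<_ (act-∏s-[] (act g (ℤ.suc x))) (act-∏s-[] (act g x)) wq<wp))
  exchange (y ∷ xs) g x p<q wq<wp = cases (ℤ.<-cmp (act w p) (act w q))
    where
    w = ∏s xs
    p = act g x
    q = act g (ℤ.suc x)
    Result : Set
    Result = ∃[ ys ] ys ⊑ y ∷ xs × suc (length ys) ≡ suc (length xs) × ∏s ys ≈ ∏s (y ∷ xs) ∙ reflection g x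
    keep : (∃[ ys ] ys ⊑ xs × suc (length ys) ≡ length xs × ∏s ys ≈ w ∙ reflection g x) → Result
    keep (ys , ys⊑xs , len , eq) = y ∷ ys , refl ∷ ys⊑xs , cong suc len ,
      (begin
        ∏s (y ∷ ys)                   ≈⟨ ≡⇒≈ (∏s-∷ y ys) ⟩
        s y ∙ ∏s ys                   ≈⟨ ∙-congˡ (s y) eq ⟩
        s y ∙ (w ∙ reflection g x)    ≈⟨ assoc (s y) w (reflection g x) ⟨
        s y ∙ w ∙ reflection g x      ≈⟨ ∙-congʳ (reflection g x) (≡⇒≈ (∏s-∷ y xs)) ⟨
        ∏s (y ∷ xs) ∙ reflection g x  ∎)
      where open ≈-Reasoning
    drop : class (act w p) ≡ y × act w q ≡ ℤ.suc (act w p) → Result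
    drop (class≡y , next) = xs , y ∷ʳ ⊆-refl , refl ,
      (begin
        w                             ≈⟨ reflection-from-left w g x next ⟨
        s (class (act w p)) ∙ w ∙ reflection g x
                                      ≈⟨ ∙-congʳ (reflection g x) (∙-congʳ w (s-cong class≡y)) ⟩
        s y ∙ w ∙ reflection g x      ≈⟨ ∙-congʳ (reflection g x) (≡⇒≈ (∏s-∷ y xs)) ⟨
        ∏s (y ∷ xs) ∙ reflection g x  ∎)
      where open ≈-Reasoning
    cases : Tri (act w p ℤ.< act w q) (act w p ≡ act w q) (act w p ℤ.> act w q) → Result
    cases (tri< lt _ _) = drop (s-flip {y} {act w p} {act w q} lt (subst₂ ℤ._<_ (act-∏s-∷ y xs q) (act-∏s-∷ y xs p) wq<wp))
    cases (tri≈ _ eq _) = ⊥-elim (ℤ.<-irrefl (act-injective w eq) p<q)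
    cases (tri> _ _ gt) = keep (exchange xs g x p<q gt)

  -- `exchange` expects the pair in increasing order. The elements w and w ∙ s j conjugate s j to
  -- the same reflection but list its pair in opposite orders, so one of them is suitable.
  oriented-reflection : ∀ w j → ∃[ g ] ∃[ x ] act g x ℤ.< act g (ℤ.suc x) × w ∙ s j ∙ w ⁻¹ ≈ reflection g x
  oriented-reflection w j = cases (ℤ.<-cmp (act w x) (act w (ℤ.suc x)))
    where
    open ≈-Reasoning
    x = + toℕ j
    σ = s (class x)
    j≡ : s j ≈ σ
    j≡ = s-cong (sym (class-toℕ j))
    Result : Set
    Result = ∃[ g ] ∃[ x ] act g x ℤ.< act g (ℤ.suc x) × w ∙ s j ∙ w ⁻¹ ≈ reflection g x
    cases : Tri (act w x ℤ.< act w (ℤ.suc x)) (act w x ≡ act w (ℤ.suc x)) (act w x ℤ.> act w (ℤ.suc x)) → Result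
    cases (tri< lt _ _) = w , x , lt , ∙-congʳ (w ⁻¹) (∙-congˡ w j≡)
    cases (tri≈ _ eq _) = ⊥-elim (ℤ.<-irrefl (act-injective w eq) (ℤ.suc[i]≤j⇒i<j ℤ.≤-refl))
    cases (tri> _ _ gt) = w ∙ σ , x ,
      subst₂ ℤ._<_ (sym (trans (act-∙ w σ x) (cong (act w) (act-s-up x))))
                   (sym (trans (act-∙ w σ (ℤ.suc x)) (cong (act w) (act-s-down x)))) gt , (begin
        w ∙ s j ∙ w ⁻¹                ≈⟨ ∙-congʳ (w ⁻¹) (∙-congˡ w j≡) ⟩
        w ∙ σ ∙ w ⁻¹                  ≈⟨ ∙-congʳ (w ⁻¹) (cancel-inverse (w ∙ σ) σ) ⟨
        w ∙ σ ∙ σ ∙ σ ⁻¹ ∙ w ⁻¹       ≈⟨ assoc (w ∙ σ ∙ σ) (σ ⁻¹) (w ⁻¹) ⟩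
        w ∙ σ ∙ σ ∙ (σ ⁻¹ ∙ w ⁻¹)     ≈⟨ ∙-congˡ (w ∙ σ ∙ σ) (⁻¹-anti-homo-∙ w σ) ⟨
        w ∙ σ ∙ σ ∙ (w ∙ σ) ⁻¹        ∎)

  -- As the reflection swaps its pair, exactly one of u and v reverses the order of this pair. A
  -- letter can be deleted from the word of that one, and the result is the other.
  exchange-reflection : ∀ {u v} us vs g x → act g x ℤ.< act g (ℤ.suc x) →
    v ≈ u ∙ reflection g x → u ≈ ∏s us → v ≈ ∏s vs →
    (∃[ ys ] ys ⊑ vs × u ≈ ∏s ys) ⊎ (∃[ ys ] suc (length ys) ≡ length us × ∏s ys ≈ v)
  exchange-reflection {u} {v} us vs g x p<q v≈ur u≈us v≈vs =
    cases (ℤ.<-cmp (act v (act g x)) (act v (act g (ℤ.suc x))))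
    where
    open ≈-Reasoning
    r = reflection g x
    Result : Set
    Result = (∃[ ys ] ys ⊑ vs × u ≈ ∏s ys) ⊎ (∃[ ys ] suc (length ys) ≡ length us × ∏s ys ≈ v)
    act-v : ∀ y → act v y ≡ act u (act r y)
    act-v y = trans (act-cong v≈ur y) (act-∙ u r y)
    v-lower : act v (act g x) ≡ act (∏s us) (act g (ℤ.suc x))
    v-lower = trans (act-v (act g x)) (trans (cong (act u) (act-reflection-lower g x)) (act-cong u≈us (act g (ℤ.suc x))))
    v-upper : act v (act g (ℤ.suc x)) ≡ act (∏s us) (act g x)
    v-upper = trans (act-v (act g (ℤ.suc x))) (trans (cong (act u) (act-reflection-upper g x)) (act-cong u≈us (act g x)))
    fromV : (∃[ ys ] ys ⊑ vs × suc (length ys) ≡ length vs × ∏s ys ≈ ∏s vs ∙ r) → Result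
    fromV (ys , ys⊑vs , _ , eq) = inj₁ (ys , ys⊑vs , ≈-sym (begin
      ∏s ys          ≈⟨ eq ⟩
      ∏s vs ∙ r      ≈⟨ ∙-congʳ r (≈-trans (≈-sym v≈vs) v≈ur) ⟩
      u ∙ r ∙ r      ≈⟨ assoc u r r ⟩
      u ∙ (r ∙ r)    ≈⟨ ∙-congˡ u (reflection-involutive g x) ⟩
      u ∙ 𝟙          ≈⟨ identityʳ u ⟩
      u              ∎))
    fromU : (∃[ ys ] ys ⊑ us × suc (length ys) ≡ length us × ∏s ys ≈ ∏s us ∙ r) → Result
    fromU (ys , _ , len , eq) = inj₂ (ys , len , ≈-trans eq (≈-trans (∙-congʳ r (≈-sym u≈us)) (≈-sym v≈ur)))
    cases : Tri (act v (act g x) ℤ.< act v (act g (ℤ.suc x))) (act v (act g x) ≡ act v (act g (ℤ.suc x)))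
                (act v (act g x) ℤ.> act v (act g (ℤ.suc x))) → Result
    cases (tri< lt _ _) = fromU (exchange us g x p<q (subst₂ ℤ._<_ v-lower v-upper lt))
    cases (tri≈ _ eq _) = ⊥-elim (ℤ.<-irrefl (act-injective v eq) p<q)
    cases (tri> _ _ gt) = fromV (exchange vs g x p<q
      (subst₂ ℤ._<_ (act-cong v≈vs (act g (ℤ.suc x))) (act-cong v≈vs (act g x)) gt))

  -- Either a letter of xs can be deleted to give u, or v has a word with ℓ(u) - 1 letters, contrary
  -- to ℓ(u) < ℓ(v). The word xs is arbitrary because subwords met along a chain may fail to be
  -- reduced.
  ⇝-subword : ∀ {u v} xs → u ⇝ v → v ≈ ∏s xs → ∃[ ys ] ys ⊑ xs × u ≈ ∏s ys
  ⇝-subword {u} {v} xs (t , (w , j , _ , t≈) , v≈ut , _ , _ , (us , (us≈ , _) , refl) , (_ , (_ , minimal) , refl) , k<l) v≈xs =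
    orient (oriented-reflection w j)
    where
    Result : Set
    Result = ∃[ ys ] ys ⊑ xs × u ≈ ∏s ys
    shorten : Result ⊎ (∃[ ys ] suc (length ys) ≡ length us × ∏s ys ≈ v) → Result
    shorten (inj₁ res) = res
    shorten (inj₂ (ys , len , eq)) = ⊥-elim (ℕ.<-asym k<l (ℕ.≤-<-trans
      (minimal ys (≈-trans (≈-sym (∏s-≈ ys)) eq)) (ℕ.≤-reflexive len)))
    orient : (∃[ g ] ∃[ x ] act g x ℤ.< act g (ℤ.suc x) × w ∙ s j ∙ w ⁻¹ ≈ reflection g x) → Result
    orient (g , x , p<q , t≈r) = shorten (exchange-reflection us xs g x p<q
      (≈-trans v≈ut (∙-congˡ u (≈-trans t≈ t≈r))) (≈-trans (≈-sym us≈) (≈-sym (∏s-≈ us))) v≈xs)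

  ≤ₐ-subword : ∀ {u v} xs → u ≤ₐ v → v ≈ ∏s xs → ∃[ ys ] ys ⊑ xs × u ≈ ∏s ys
  ≤ₐ-subword xs nil v≈ = xs , ⊆-refl , v≈
  ≤ₐ-subword xs (r ◅ rs) v≈ with ≤ₐ-subword xs rs v≈
  ≤ₐ-subword xs (inj₁ u≈u′ ◅ rs) v≈ | ys , ys⊑ , eq = ys , ys⊑ , ≈-trans u≈u′ eq
  ≤ₐ-subword xs (inj₂ u⇝u′ ◅ rs) v≈ | ys , ys⊑ , eq with ⇝-subword ys u⇝u′ eq
  ... | zs , zs⊑ , eq′ = zs , Sub.⊆-trans zs⊑ ys⊑ , eq′

-- Lists with a relation between earlier and later entries.

module _ {a} {A : Set a} where

  AllPairs-++⁻ʳ : ∀ {r} {R : A → A → Set r} xs {ys} → AllPairs R (xs ++ ys) → AllPairs R ys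
  AllPairs-++⁻ʳ []       Rys       = Rys
  AllPairs-++⁻ʳ (x ∷ xs) (_ ∷ Rxs) = AllPairs-++⁻ʳ xs Rxs

  AllPairs-delete : ∀ {r} {R : A → A → Set r} xs {y ys} → AllPairs R (xs ++ y ∷ ys) → AllPairs R (xs ++ ys)
  AllPairs-delete []       (_ ∷ Rys)  = Rys
  AllPairs-delete (x ∷ xs) (Rx ∷ Rxs) =
    All.++⁺ (All.++⁻ˡ xs Rx) (All.tail (All.++⁻ʳ xs Rx)) ∷ AllPairs-delete xs Rxs

  AllPairs-before : ∀ {r} {R : A → A → Set r} xs {y ys} → AllPairs R (xs ++ y ∷ ys) → All (λ x → R x y) xs
  AllPairs-before []       _          = []
  AllPairs-before (x ∷ xs) (Rx ∷ Rxs) = All.head (All.++⁻ʳ xs Rx) ∷ AllPairs-before xs Rxs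

  AllPairs-after : ∀ {r} {R : A → A → Set r} xs {y ys} → AllPairs R (xs ++ y ∷ ys) → All (R y) ys
  AllPairs-after xs Rxs = AllPairs.head (AllPairs-++⁻ʳ xs Rxs)

  AllPairs-⊑ : ∀ {r} {R : A → A → Set r} {xs ys} → xs ⊑ ys → AllPairs R ys → AllPairs R xs
  AllPairs-⊑ []         []         = []
  AllPairs-⊑ (_ ∷ʳ τ)   (_ ∷ Rys)  = AllPairs-⊑ τ Rys
  AllPairs-⊑ (refl ∷ τ) (Ry ∷ Rys) = All-resp-⊆ τ Ry ∷ AllPairs-⊑ τ Rys

  ∈-delete : ∀ xs {y} {z : A} {ys} → z ∈ˡ xs ++ y ∷ ys → z ≢ y → z ∈ˡ xs ++ ys
  ∈-delete xs z∈ z≢y with ∈-++⁻ xs z∈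
  ... | inj₁ z∈xs           = ∈-++⁺ˡ z∈xs
  ... | inj₂ (here z≡y)     = contradiction z≡y z≢y
  ... | inj₂ (there z∈ys)   = ∈-++⁺ʳ xs z∈ys

  ∈-undelete : ∀ xs {y} {z : A} {ys} → z ∈ˡ xs ++ ys → z ∈ˡ xs ++ y ∷ ys
  ∈-undelete xs z∈ with ∈-++⁻ xs z∈
  ... | inj₁ z∈xs = ∈-++⁺ˡ z∈xs
  ... | inj₂ z∈ys = ∈-++⁺ʳ xs (there z∈ys)

  length-delete : ∀ xs {y : A} {ys} → length (xs ++ y ∷ ys) ≡ suc (length (xs ++ ys))
  length-delete []       = refl
  length-delete (_ ∷ xs) = cong suc (length-delete xs)

  Unique-length : ∀ {xs ys : List A} → Unique xs → (∀ {z} → z ∈ˡ xs → z ∈ˡ ys) → length xs ℕ.≤ length ys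
  Unique-length {[]}     _            _     = ℕ.z≤n
  Unique-length {x ∷ xs} (x∉xs ∷ xs!) xs⊆ys with ∈-∃++ (xs⊆ys (here refl))
  ... | as , bs , refl = subst (suc (length xs) ℕ.≤_) (sym (length-delete as))
    (ℕ.s≤s (Unique-length xs! (λ z∈xs → ∈-delete as (xs⊆ys (there z∈xs))
      (λ z≡x → All.lookup x∉xs z∈xs (sym z≡x)))))

-- Ordered words.

module OrderedWords (n : ℕ) .{{_ : NonTrivial n}} where
  open IwahoriWeyl n
  open AffineAction n
  open Words n
  open DecMembership (_≟_ {n}) using () renaming (_∈?_ to _∈ˡ?_) public

  -- The products of the words in which this holds for each letter x before y are
  -- the elements w_J of the case Ī = ℤ/n.
  Precedes : ℤ/n → ℤ/n → Set
  Precedes x y = x ≢ y × x ≢ y ⊕ 1ℤ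

  Ordered : List ℤ/n → Set
  Ordered = AllPairs Precedes

  Ordered⇒Unique : ∀ {xs} → Ordered xs → Unique xs
  Ordered⇒Unique = AllPairs.map proj₁

  ∏s-fix : ∀ {xs} y → All (λ a → class y ≢ a × class y ≢ a ⊕ 1ℤ) xs → act (∏s xs) y ≡ y
  ∏s-fix y [] = act-∏s-[] y
  ∏s-fix {x ∷ xs} y ((p , q) ∷ ps) = trans (act-∏s-∷ x xs y)
    (trans (cong (act (s x)) (∏s-fix y ps)) (act-s-fix y p q))

  -- The letters to the right of m are neither m nor m - 1, so they fix m. Those to the left are
  -- neither m nor m + 1, so they fix m + 1.
  ordered-suc : ∀ {xs} m → Ordered xs → class m ∈ˡ xs → act (∏s xs) m ≡ ℤ.suc m
  ordered-suc {x ∷ xs} m (Px ∷ Pxs) (here refl) = trans (act-∏s-∷ x xs m)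
    (trans (cong (act (s x)) (∏s-fix m Px)) (act-s-up m))
  ordered-suc {x ∷ xs} m (Px ∷ Pxs) (there m∈xs) = trans (act-∏s-∷ x xs m)
    (trans (cong (act (s x)) (ordered-suc m Pxs m∈xs)) (act-s-fix (ℤ.suc m)
      (λ p → proj₂ x>m (trans (sym p) (class-suc m)))
      (λ p → proj₁ x>m (sym (⊕1-injective (trans (sym (class-suc m)) p))))))
    where x>m = All.lookup Px m∈xs

  -- The stabiliser of the half-line up to m. Asking for both directions makes it closed under
  -- inverses.
  Preserves : ℤ → W̃ → Set
  Preserves m u = ∀ y → (y ℤ.≤ m → act u y ℤ.≤ m) × (act u y ℤ.≤ m → y ℤ.≤ m)

  Preserves-cong : ∀ {m u v} → u ≈ v → Preserves m u → Preserves m v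
  Preserves-cong {m} u≈v p y = (λ le → subst (ℤ._≤ m) (act-cong u≈v y) (proj₁ (p y) le))
                             , (λ le → proj₂ (p y) (subst (ℤ._≤ m) (sym (act-cong u≈v y)) le))

  Preserves-𝟙 : ∀ m → Preserves m 𝟙
  Preserves-𝟙 m y = subst (ℤ._≤ m) (sym (act-𝟙 y)) , subst (ℤ._≤ m) (act-𝟙 y)

  Preserves-∙ : ∀ {m} u v → Preserves m u → Preserves m v → Preserves m (u ∙ v)
  Preserves-∙ {m} u v p q y =
    (λ le → subst (ℤ._≤ m) (sym (act-∙ u v y)) (proj₁ (p (act v y)) (proj₁ (q y) le))) ,
    (λ le → proj₂ (q y) (proj₂ (p (act v y)) (subst (ℤ._≤ m) (act-∙ u v y) le)))

  Preserves-⁻¹ : ∀ {m} u → Preserves m u → Preserves m (u ⁻¹)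
  Preserves-⁻¹ {m} u p y =
    (λ le → proj₂ (p (act (u ⁻¹) y)) (subst (ℤ._≤ m) (sym (act-⁻¹ʳ u y)) le)) ,
    (λ le → subst (ℤ._≤ m) (act-⁻¹ʳ u y) (proj₁ (p (act (u ⁻¹) y)) le))

  act-s-≤ : ∀ {j} m → class m ≢ j → ∀ {y} → y ℤ.≤ m → act (s j) y ℤ.≤ m
  act-s-≤ {j} m m≢j {y} = main (position j y)
    where
    main : ∀ {y} → Position j y → y ℤ.≤ m → act (s j) y ℤ.≤ m
    main (up c eq) le = subst (ℤ._≤ m) (sym eq)
      (ℤ.i<j⇒suc[i]≤j (ℤ.≤∧≢⇒< le (λ y≡m → m≢j (trans (cong class (sym y≡m)) c))))
    main (down z _ eq) le = subst (ℤ._≤ m) (sym eq) (ℤ.≤-trans (ℤ.i≤suc[i] z) le)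
    main (off _ _ eq)  le = subst (ℤ._≤ m) (sym eq) le

  Preserves-s : ∀ {j} m → class m ≢ j → Preserves m (s j)
  Preserves-s {j} m m≢j y = act-s-≤ m m≢j , λ le → subst (ℤ._≤ m)
    (trans (sym (act-∙ (s j) (s j) y)) (trans (act-cong (s-involutive j) y) (act-𝟙 y)))
    (act-s-≤ m m≢j le)

  Preserves-∏s : ∀ {m} xs → class m ∉ˡ xs → Preserves m (∏s xs)
  Preserves-∏s {m} []       _    = Preserves-cong (≡⇒≈ (sym ∏s-[])) (Preserves-𝟙 m)
  Preserves-∏s {m} (x ∷ xs) m∉xs = Preserves-cong (≡⇒≈ (sym (∏s-∷ x xs)))
    (Preserves-∙ (s x) (∏s xs) (Preserves-s m (m∉xs ∘ here)) (Preserves-∏s xs (m∉xs ∘ there)))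

  -- This detects a whole block: see `climb-block`. In the induction the first letter matters only
  -- if it is the class of y, as otherwise it preserves the half-line up to y; if it is, the z found
  -- for y + 1 serves.
  climb : ∀ {xs} → Ordered xs → ∀ y → ∃[ z ] y ℤ.≤ z × act (∏s xs) z ℤ.≤ y
  climb {[]}     []         y = y , ℤ.≤-refl , ℤ.≤-reflexive (act-∏s-[] y)
  climb {x ∷ xs} (Px ∷ Pxs) y with class y ≟ x
  ... | no y≢x = let z , y≤z , wz≤y = climb Pxs y in
    z , y≤z , subst (ℤ._≤ y) (sym (act-∏s-∷ x xs z)) (act-s-≤ y y≢x wz≤y)
  -- The remaining letters fix y, so they do not send z > y to y. Every other value up to y + 1 is
  -- sent by the first letter to a value up to y.
  ... | yes refl = let z , y<z , wz≤1+y = climb Pxs (ℤ.suc y) in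
    z , ℤ.≤-trans (ℤ.i≤suc[i] y) y<z , subst (ℤ._≤ y) (sym (act-∏s-∷ x xs z))
      (main (position x (act (∏s xs) z)) wz≤1+y
        (λ wz≡y → ℤ.<-irrefl (act-injective (∏s xs) (trans (∏s-fix y Px) (sym wz≡y))) (ℤ.suc[i]≤j⇒i<j y<z)))
    where
    main : ∀ {v} → Position (class y) v → v ℤ.≤ ℤ.suc y → v ≢ y → act (s (class y)) v ℤ.≤ y
    main (up c eq) le v≢y = subst (ℤ._≤ y) (sym eq) (ℤ.i<j⇒suc[i]≤j
      (ℤ.≤∧≢⇒< (<1+⇒≤ (ℤ.≤∧≢⇒< le (λ v≡ → ⊕1-≢ (class y) (trans (sym (class-suc y)) (trans (cong class (sym v≡)) c))))) v≢y))
    main (down v _ eq) le _ = subst (ℤ._≤ y) (sym eq) (<1+⇒≤ (ℤ.suc[i]≤j⇒i<j le))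
    main (off _ c eq) le _ = subst (ℤ._≤ y) (sym eq) (<1+⇒≤ (ℤ.≤∧≢⇒< le (λ v≡ → c (trans (cong class v≡) (class-suc y)))))

  ordered-letters : ∀ {xs} ys → Ordered xs → ∏s xs ≈ ∏s ys → ∀ {m} → m ∈ˡ xs → m ∈ˡ ys
  ordered-letters {xs} ys Pxs eq {m} m∈xs with m ∈ˡ? ys
  ... | yes m∈ys = m∈ys
  ... | no  m∉ys = contradiction
    (subst (ℤ._≤ y) (trans (sym (act-cong eq y)) (ordered-suc y Pxs (subst (_∈ˡ xs) (sym y≡m) m∈xs)))
      (proj₁ (Preserves-∏s ys (m∉ys ∘ subst (_∈ˡ ys) y≡m) y) ℤ.≤-refl))
    (ℤ.<⇒≱ (ℤ.suc[i]≤j⇒i<j ℤ.≤-refl))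
    where
    y = + toℕ m
    y≡m : class y ≡ m
    y≡m = class-toℕ m

  ordered-reduced : ∀ {xs w} → Ordered xs → w ≈ ∏s xs → IsReducedWord xs w
  ordered-reduced {xs} Pxs w≈ = ≈-trans (≈-sym (∏s-≈ xs)) (≈-sym w≈) , λ ys eq →
    Unique-length (Ordered⇒Unique Pxs)
      (ordered-letters ys Pxs (≈-trans (≈-sym w≈) (≈-trans (≈-sym eq) (≈-sym (∏s-≈ ys)))))

  Commute : ℤ/n → ℤ/n → Set
  Commute x y = x ≢ y × x ≢ y ⊕ 1ℤ × y ≢ x ⊕ 1ℤ

  ∏s-pull : ∀ {xs} x ys → All (Commute x) xs → ∏s (xs ++ x ∷ ys) ≈ s x ∙ ∏s (xs ++ ys)
  ∏s-pull {[]}     x ys [] = ≡⇒≈ (∏s-∷ x ys)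
  ∏s-pull {z ∷ xs} x ys ((p , q , r) ∷ ps) = begin
    ∏s (z ∷ xs ++ x ∷ ys)       ≈⟨ ≡⇒≈ (∏s-∷ z (xs ++ x ∷ ys)) ⟩
    s z ∙ ∏s (xs ++ x ∷ ys)     ≈⟨ ∙-congˡ (s z) (∏s-pull x ys ps) ⟩
    s z ∙ (s x ∙ ∏s (xs ++ ys)) ≈⟨ assoc (s z) (s x) (∏s (xs ++ ys)) ⟨
    s z ∙ s x ∙ ∏s (xs ++ ys)   ≈⟨ ∙-congʳ (∏s (xs ++ ys)) (s-commute p q r) ⟨
    s x ∙ s z ∙ ∏s (xs ++ ys)   ≈⟨ assoc (s x) (s z) (∏s (xs ++ ys)) ⟩
    s x ∙ (s z ∙ ∏s (xs ++ ys)) ≈⟨ ∙-congˡ (s x) (≡⇒≈ (∏s-∷ z (xs ++ ys))) ⟨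
    s x ∙ ∏s (z ∷ xs ++ ys)     ∎
    where open ≈-Reasoning

  ∏s-push-tail : ∀ {ys} x → All (Commute x) ys → s x ∙ ∏s ys ≈ ∏s ys ∙ s x
  ∏s-push-tail {[]} x [] = begin
    s x ∙ ∏s []   ≈⟨ ∙-congˡ (s x) (≡⇒≈ ∏s-[]) ⟩
    s x ∙ 𝟙       ≈⟨ identityʳ (s x) ⟩
    s x           ≈⟨ identityˡ (s x) ⟨
    𝟙 ∙ s x       ≈⟨ ∙-congʳ (s x) (≡⇒≈ ∏s-[]) ⟨
    ∏s [] ∙ s x   ∎
    where open ≈-Reasoning
  ∏s-push-tail {z ∷ ys} x ((p , q , r) ∷ ps) = begin
    s x ∙ ∏s (z ∷ ys)    ≈⟨ ∙-congˡ (s x) (≡⇒≈ (∏s-∷ z ys)) ⟩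
    s x ∙ (s z ∙ ∏s ys)  ≈⟨ assoc (s x) (s z) (∏s ys) ⟨
    s x ∙ s z ∙ ∏s ys    ≈⟨ ∙-congʳ (∏s ys) (s-commute p q r) ⟩
    s z ∙ s x ∙ ∏s ys    ≈⟨ assoc (s z) (s x) (∏s ys) ⟩
    s z ∙ (s x ∙ ∏s ys)  ≈⟨ ∙-congˡ (s z) (∏s-push-tail x ps) ⟩
    s z ∙ (∏s ys ∙ s x)  ≈⟨ assoc (s z) (∏s ys) (s x) ⟨
    s z ∙ ∏s ys ∙ s x    ≈⟨ ∙-congʳ (s x) (≡⇒≈ (∏s-∷ z ys)) ⟨
    ∏s (z ∷ ys) ∙ s x    ∎
    where open ≈-Reasoning

  ∏s-push : ∀ xs x {ys} → All (Commute x) ys → ∏s (xs ++ x ∷ ys) ≈ ∏s (xs ++ ys) ∙ s x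
  ∏s-push xs x {ys} ps = begin
    ∏s (xs ++ x ∷ ys)          ≈⟨ ∏s-++ xs (x ∷ ys) ⟩
    ∏s xs ∙ ∏s (x ∷ ys)        ≈⟨ ∙-congˡ (∏s xs) (≡⇒≈ (∏s-∷ x ys)) ⟩
    ∏s xs ∙ (s x ∙ ∏s ys)      ≈⟨ ∙-congˡ (∏s xs) (∏s-push-tail x ps) ⟩
    ∏s xs ∙ (∏s ys ∙ s x)      ≈⟨ assoc (∏s xs) (∏s ys) (s x) ⟨
    ∏s xs ∙ ∏s ys ∙ s x        ≈⟨ ∙-congʳ (s x) (∏s-++ xs ys) ⟨
    ∏s (xs ++ ys) ∙ s x        ∎
    where open ≈-Reasoning

  -- The first letter of xs can be pulled to the front of ys.
  ordered-unique : ∀ {xs ys} → Ordered xs → Ordered ys →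
                   (∀ {m} → m ∈ˡ xs → m ∈ˡ ys) → (∀ {m} → m ∈ˡ ys → m ∈ˡ xs) → ∏s xs ≈ ∏s ys
  ordered-unique {[]} {[]}    _ _ _ _ = ≈-refl {∏s []}
  ordered-unique {[]} {_ ∷ _} _ _ _ ys⊆xs with ys⊆xs (here refl)
  ... | ()
  ordered-unique {x ∷ xs} {ys} (Px ∷ Pxs) Pys xs⊆ys ys⊆xs with ∈-∃++ (xs⊆ys (here refl))
  ... | as , bs , refl = ≈-trans (≡⇒≈ (∏s-∷ x xs)) (≈-trans (∙-congˡ (s x)
          (ordered-unique Pxs (AllPairs-delete as Pys) to from))
          (≈-sym (∏s-pull x bs (All.tabulate commute))))
    where
    before : All (λ a → Precedes a x) as
    before = AllPairs-before as Pys
    x∉ : ∀ {m} → m ∈ˡ as ++ bs → m ≢ x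
    x∉ m∈ refl with ∈-++⁻ as m∈
    ... | inj₁ m∈as = proj₁ (All.lookup before m∈as) refl
    ... | inj₂ m∈bs = proj₁ (All.lookup (AllPairs-after as Pys) m∈bs) refl
    from : ∀ {m} → m ∈ˡ as ++ bs → m ∈ˡ xs
    from m∈ with ys⊆xs (∈-undelete as m∈)
    ... | here m≡x   = contradiction m≡x (x∉ m∈)
    ... | there m∈xs = m∈xs
    to : ∀ {m} → m ∈ˡ xs → m ∈ˡ as ++ bs
    to m∈xs = ∈-delete as (xs⊆ys (there m∈xs)) (λ m≡x → proj₁ (All.lookup Px m∈xs) (sym m≡x))
    commute : ∀ {a} → a ∈ˡ as → Commute x a
    commute a∈as = (λ x≡a → proj₁ (All.lookup before a∈as) (sym x≡a))
                 , proj₂ (All.lookup Px (from (∈-++⁺ˡ a∈as)))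
                 , proj₂ (All.lookup before a∈as)

  -- Inserting x in front of ys amounts to multiplying on the right by the conjugate of `s x` under
  -- the tail, b ⁻¹ ∙ s x ∙ b. Both words are ordered, hence reduced, so the lengths differ by one.
  ordered-⇝ : ∀ xs x ys → Ordered (xs ++ x ∷ ys) → ∏s (xs ++ ys) ⇝ ∏s (xs ++ x ∷ ys)
  ordered-⇝ xs x ys P = b ⁻¹ ∙ s x ∙ (b ⁻¹) ⁻¹
    , (b ⁻¹ , x , ⁻¹-Wₐ {b} (∏s-Wₐ ys) , ≈-refl {b ⁻¹ ∙ s x ∙ (b ⁻¹) ⁻¹})
    , product
    , length (xs ++ ys) , length (xs ++ x ∷ ys)
    , (xs ++ ys , ordered-reduced (AllPairs-delete xs P) (≈-refl {∏s (xs ++ ys)}) , refl)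
    , (xs ++ x ∷ ys , ordered-reduced P (≈-refl {∏s (xs ++ x ∷ ys)}) , refl)
    , ℕ.≤-reflexive (sym (length-delete xs))
    where
    open ≈-Reasoning
    a = ∏s xs
    b = ∏s ys
    product : ∏s (xs ++ x ∷ ys) ≈ ∏s (xs ++ ys) ∙ (b ⁻¹ ∙ s x ∙ (b ⁻¹) ⁻¹)
    product = begin
      ∏s (xs ++ x ∷ ys)                           ≈⟨ ∏s-++ xs (x ∷ ys) ⟩
      a ∙ ∏s (x ∷ ys)                             ≈⟨ ∙-congˡ a (≡⇒≈ (∏s-∷ x ys)) ⟩
      a ∙ (s x ∙ b)                               ≈⟨ ∙-congˡ a (∙-congˡ (s x) (⁻¹-involutive b)) ⟨
      a ∙ (s x ∙ (b ⁻¹) ⁻¹)                       ≈⟨ assoc a (s x) ((b ⁻¹) ⁻¹) ⟨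
      a ∙ s x ∙ (b ⁻¹) ⁻¹                         ≈⟨ ∙-congʳ ((b ⁻¹) ⁻¹) (∙-congʳ (s x) (cancel-inverse a b)) ⟨
      a ∙ b ∙ b ⁻¹ ∙ s x ∙ (b ⁻¹) ⁻¹              ≈⟨ ∙-congʳ ((b ⁻¹) ⁻¹) (assoc (a ∙ b) (b ⁻¹) (s x)) ⟩
      a ∙ b ∙ (b ⁻¹ ∙ s x) ∙ (b ⁻¹) ⁻¹            ≈⟨ assoc (a ∙ b) (b ⁻¹ ∙ s x) ((b ⁻¹) ⁻¹) ⟩
      a ∙ b ∙ (b ⁻¹ ∙ s x ∙ (b ⁻¹) ⁻¹)            ≈⟨ ∙-congʳ (b ⁻¹ ∙ s x ∙ (b ⁻¹) ⁻¹) (∏s-++ xs ys) ⟨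
      ∏s (xs ++ ys) ∙ (b ⁻¹ ∙ s x ∙ (b ⁻¹) ⁻¹)    ∎

  -- The absent letters are inserted one at a time. The prefix `as` collects the kept letters, and
  -- all intermediate words are subwords of an ordered word, hence ordered.
  ordered-≤ₐ : ∀ as {ys xs} → ys ⊑ xs → Ordered (as ++ xs) → ∏s (as ++ ys) ≤ₐ ∏s (as ++ xs)
  ordered-≤ₐ as [] P = nil
  ordered-≤ₐ as (_∷ʳ_ {xs} {ys} x τ) P = ordered-≤ₐ as τ (AllPairs-delete as P) ◅◅ (inj₂ (ordered-⇝ as x ys P) ◅ nil)
  ordered-≤ₐ as (_∷_ {x} {xs} {_} {ys} refl τ) P = subst₂ (λ us vs → ∏s us ≤ₐ ∏s vs)
    (++-assoc as List.[ x ] xs) (++-assoc as List.[ x ] ys)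
    (ordered-≤ₐ (as ++ List.[ x ]) τ (subst Ordered (sym (++-assoc as List.[ x ] ys)) P))

-- Gaps, blocks, and the words of the translations.

module _ {a p} {A : Set a} {P : Pred A p} (P? : Decidable P) where

  find-applyUpTo : ∀ (f : ℕ → A) m d → let r = fromMaybe d (find P? (applyUpTo f m)) in
    (∃[ k ] k ℕ.< m × r ≡ f k × P (f k) × (∀ {j} → j ℕ.< k → ¬ P (f j))) ⊎ (∀ {j} → j ℕ.< m → ¬ P (f j))
  find-applyUpTo f ℕ.zero  d = inj₂ λ ()
  find-applyUpTo f (suc m) d with P? (f 0)
  ... | yes Pf0 = inj₁ (0 , ℕ.z<s , refl , Pf0 , λ ())
  ... | no ¬Pf0 with find-applyUpTo (f ∘ suc) m d
  ...   | inj₁ (k , k<m , eq , Pfk , before) = inj₁ (suc k , ℕ.s<s k<m , eq , Pfk ,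
            λ { {ℕ.zero} _ → ¬Pf0 ; {suc j} (ℕ.s<s j<k) → before j<k })
  ...   | inj₂ none = inj₂ λ { {ℕ.zero} _ → ¬Pf0 ; {suc j} (ℕ.s<s j<m) → none j<m }

AllPairs-relative : ∀ {a p r} {A : Set a} {P : Pred A p} {R : A → A → Set r} {xs} →
  All P xs → AllPairs (λ x y → P x → P y → R x y) xs → AllPairs R xs
AllPairs-relative []         []         = []
AllPairs-relative (px ∷ pxs) (Rx ∷ Rxs) =
  All.zipWith (λ (py , f) → f px py) (pxs , Rx) ∷ AllPairs-relative pxs Rxs

module Blocks (n : ℕ) .{{_ : NonTrivial n}} (Ī : Subset n) where
  open IwahoriWeyl n
  open AffineAction n
  open Words n
  open OrderedWords n
  open Parahoric Ī using (gap; w-B; w; P_I)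

  ⊕-⊕ : ∀ i p q → i ⊕ + p ⊕ + q ≡ i ⊕ + (p ℕ.+ q)
  ⊕-⊕ i p q = trans (class-⊕ (+ toℕ i + + p) (+ q)) (cong class (ℤ.+-assoc (+ toℕ i) (+ p) (+ q)))

  ⊕-suc : ∀ i k → i ⊕ + suc k ≡ i ⊕ + k ⊕ 1ℤ
  ⊕-suc i k = sym (trans (⊕-⊕ i k 1) (cong (λ l → i ⊕ + l) (ℕ.+-comm k 1)))

  ⊕-n : ∀ i → i ⊕ + n ≡ i
  ⊕-n i = trans (cong (i ⊕_) (sym (ℤ.*-identityˡ (+ n)))) (trans (class-shift (+ toℕ i) 1ℤ) (class-toℕ i))

  ⊕-0 : ∀ i → i ⊕ + 0 ≡ i
  ⊕-0 i = trans (cong class (ℤ.+-identityʳ (+ toℕ i))) (class-toℕ i)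

  ⊕-injective : ∀ i {p q} → p ℕ.< n → q ℕ.< n → i ⊕ + p ≡ i ⊕ + q → p ≡ q
  ⊕-injective i {p} {q} p<n q<n eq = trans (sym (toℕ-class-< p<n)) (trans (cong toℕ class≡) (toℕ-class-< q<n))
    where
    cancel : ∀ a b → a + b - a ≡ b
    cancel = solve-∀
    back : ∀ b → i ⊕ b ⊕ - (+ toℕ i) ≡ class b
    back b = trans (class-⊕ (+ toℕ i + b) (- (+ toℕ i))) (cong class (cancel (+ toℕ i) b))
    class≡ : class (+ p) ≡ class (+ q)
    class≡ = trans (sym (back (+ p))) (trans (cong (_⊕ - (+ toℕ i)) eq) (back (+ q)))

  ⊕-surjective : ∀ i j → ∃[ k ] k ℕ.< n × j ≡ i ⊕ + k
  ⊕-surjective i j = toℕ k , toℕ<n k , sym (begin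
    i ⊕ + toℕ k                       ≡⟨ cong class (ℤ.+-comm (+ toℕ i) (+ toℕ k)) ⟩
    k ⊕ + toℕ i                       ≡⟨ class-⊕ (+ toℕ j - + toℕ i) (+ toℕ i) ⟩
    class (+ toℕ j - + toℕ i + + toℕ i) ≡⟨ cong class (cancel (+ toℕ j) (+ toℕ i)) ⟩
    class (+ toℕ j)                   ≡⟨ class-toℕ j ⟩
    j                                 ∎)
    where
    open ≡-Reasoning
    k = class (+ toℕ j - + toℕ i)
    cancel : ∀ a b → a - b + b ≡ a
    cancel = solve-∀

  -- The only danger is wrapping around: for q = n - 1 the successor of i + q is i itself, and 0 < p
  -- excludes it.
  precedes : ∀ i {p q} → 0 ℕ.< p → p ℕ.< q → q ℕ.< n → Precedes (i ⊕ + p) (i ⊕ + q)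
  precedes i {p} {q} 0<p p<q q<n = (λ eq → ℕ.<⇒≢ p<q (⊕-injective i (ℕ.<-trans p<q q<n) q<n eq)) , next
    where
    next : i ⊕ + p ≢ i ⊕ + q ⊕ 1ℤ
    next eq with ℕ.m≤n⇒m<n∨m≡n q<n | trans eq (trans (⊕-⊕ i q 1) (cong (λ k → i ⊕ + k) (ℕ.+-comm q 1)))
    ... | inj₁ 1+q<n | eq′ = ℕ.<⇒≢ (ℕ.m<n⇒m<1+n p<q) (⊕-injective i (ℕ.<-trans p<q q<n) 1+q<n eq′)
    ... | inj₂ refl  | eq′ = ℕ.<⇒≢ 0<p (sym (⊕-injective i (ℕ.<-trans p<q q<n) (ℕ.<-trans ℕ.z<s 1<n)
                               (trans eq′ (trans (⊕-n i) (sym (⊕-0 i))))))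

  private
    gap-cases : ∀ i → (∃[ k ] k ℕ.< n × gap i ≡ suc k × i ⊕ + suc k ∈ Ī × (∀ {j} → j ℕ.< k → i ⊕ + suc j ∉ Ī)) ⊎
                      (∀ {j} → j ℕ.< n → i ⊕ + suc j ∉ Ī)
    gap-cases i = subst (λ ls → (∃[ k ] k ℕ.< n × fromMaybe n (find (λ ℓ → (i ⊕ + ℓ) ∈? Ī) ls) ≡ suc k ×
                                  i ⊕ + suc k ∈ Ī × (∀ {j} → j ℕ.< k → i ⊕ + suc j ∉ Ī)) ⊎
                                (∀ {j} → j ℕ.< n → i ⊕ + suc j ∉ Ī))
      (sym (map-upTo suc n)) (find-applyUpTo (λ ℓ → (i ⊕ + ℓ) ∈? Ī) suc n n)

    module _ {i} (i∈Ī : i ∈ Ī) where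
      gap-spec : ∃[ k ] k ℕ.< n × gap i ≡ suc k × i ⊕ + suc k ∈ Ī × (∀ {j} → j ℕ.< k → i ⊕ + suc j ∉ Ī)
      gap-spec with gap-cases i
      ... | inj₁ spec = spec
      -- At distance n the search meets i itself.
      ... | inj₂ none = contradiction i+n∈Ī (none (ℕ.≤-reflexive (ℕ.suc-pred n {{n≢0}})))
        where
        n≢0 = nonTrivial⇒nonZero n
        i+n∈Ī : i ⊕ + suc (ℕ.pred n) ∈ Ī
        i+n∈Ī = subst (_∈ Ī) (sym (trans (cong (λ k → i ⊕ + k) (ℕ.suc-pred n {{n≢0}})) (⊕-n i))) i∈Ī

  module _ {i} (i∈Ī : i ∈ Ī) where
    0<gap : 0 ℕ.< gap i
    0<gap with gap-spec i∈Ī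
    ... | k , _ , eq , _ = subst (0 ℕ.<_) (sym eq) ℕ.z<s

    ⊕-gap-∈ : i ⊕ + gap i ∈ Ī
    ⊕-gap-∈ with gap-spec i∈Ī
    ... | k , _ , eq , in-Ī , _ = subst (λ ℓ → i ⊕ + ℓ ∈ Ī) (sym eq) in-Ī

    gap-minimal : ∀ {m} → 0 ℕ.< m → i ⊕ + m ∈ Ī → gap i ℕ.≤ m
    gap-minimal {suc m} _ in-Ī with gap-spec i∈Ī
    ... | k , _ , eq , _ , before = subst (ℕ._≤ suc m) (sym eq) (ℕ.s≤s (ℕ.≮⇒≥ (λ m<k → before m<k in-Ī)))

  -- Contains every residue except `i₀`; followed by τ it is the translation with zero coordinate i₀
  -- + 1, see `translation≈run`.
  run : ℤ/n → List ℤ/n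
  run i₀ = map (λ k → i₀ ⊕ + suc k) (upTo (n ℕ.∸ 1))

  <pred⇒<n : ∀ {k} → k ℕ.< n ℕ.∸ 1 → suc k ℕ.< n
  <pred⇒<n {k} k<n-1 = subst (ℕ._≤ n) (ℕ.+-comm (suc k) 1) (ℕ.m≤o∸n⇒m+n≤o (suc k) (ℕ.<⇒≤ 1<n) k<n-1)

  ∈-run⁻ : ∀ {i₀ j} → j ∈ˡ run i₀ → ∃[ k ] 0 ℕ.< k × k ℕ.< n × j ≡ i₀ ⊕ + k
  ∈-run⁻ {i₀} j∈ with ∈-map⁻ (λ k → i₀ ⊕ + suc k) j∈
  ... | k , k∈ , eq = suc k , ℕ.z<s , <pred⇒<n (∈-upTo⁻ k∈) , eq

  ∈-run⁺ : ∀ {i₀ j} → j ≢ i₀ → j ∈ˡ run i₀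
  ∈-run⁺ {i₀} {j} j≢i₀ with ⊕-surjective i₀ j
  ... | ℕ.zero , _ , eq     = contradiction (trans eq (⊕-0 i₀)) j≢i₀
  ... | suc k , 1+k<n , refl = ∈-map⁺ (λ k → i₀ ⊕ + suc k) (∈-upTo⁺ (ℕ.∸-monoˡ-≤ 1 1+k<n))

  run-ordered : ∀ i₀ → Ordered (run i₀)
  run-ordered i₀ = AllPairs.map⁺ (AllPairs.applyUpTo⁺₁ id (n ℕ.∸ 1)
    (λ i<j j<n-1 → precedes i₀ ℕ.z<s (ℕ.s<s i<j) (<pred⇒<n j<n-1)))

  base∉run : ∀ i₀ → i₀ ∉ˡ run i₀
  base∉run i₀ i₀∈ with ∈-run⁻ {i₀} i₀∈
  ... | k , 0<k , k<n , eq = ℕ.<⇒≢ 0<k (⊕-injective i₀ (ℕ.<-trans ℕ.z<s 1<n) k<n (trans (⊕-0 i₀) eq))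

  block : ℤ/n → List ℤ/n
  block j = map (λ k → j ⊕ + k) (upTo (gap j))

  letters : Subset n → ℤ/n → List ℤ/n
  letters J i₀ = concat (map block (filter (_∈? J) (run i₀)))

  w≈ : ∀ J i₀ → w J i₀ ≈ ∏s (letters J i₀)
  w≈ J i₀ = blocks (filter (_∈? J) (run i₀))
    where
    open ≈-Reasoning
    w-B≈ : ∀ j → w-B j ≈ ∏s (block j)
    w-B≈ j = ≈-trans (≡⇒≈ (cong ∏ (map-∘ {g = s} {f = λ k → j ⊕ + k} (upTo (gap j))))) (≈-sym (∏s-≈ (block j)))
    blocks : ∀ js → ∏ (map w-B js) ≈ ∏s (concat (map block js))
    blocks []       = ≡⇒≈ (sym ∏s-[])
    blocks (j ∷ js) = begin
      w-B j ∙ ∏ (map w-B js)                        ≈⟨ ∙-congʳ (∏ (map w-B js)) (w-B≈ j) ⟩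
      ∏s (block j) ∙ ∏ (map w-B js)                 ≈⟨ ∙-congˡ (∏s (block j)) (blocks js) ⟩
      ∏s (block j) ∙ ∏s (concat (map block js))     ≈⟨ ∏s-++ (block j) (concat (map block js)) ⟨
      ∏s (concat (map block (j ∷ js)))              ∎

  Letter : Subset n → ℤ/n → Set
  Letter J m = ∃[ j ] ∃[ c ] j ∈ J × c ℕ.< gap j × m ≡ j ⊕ + c

  module _ {J : Subset n} {i₀ : ℤ/n} where
    ∈-letters⁻ : ∀ {m} → m ∈ˡ letters J i₀ → Letter J m
    ∈-letters⁻ m∈ with ∈-concat⁻′ (map block (filter (_∈? J) (run i₀))) m∈
    ... | _ , m∈b , b∈ with ∈-map⁻ block b∈
    ... | j , j∈ , refl with ∈-map⁻ (λ k → j ⊕ + k) m∈b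
    ... | c , c∈ , eq = j , c , proj₂ (∈-filter⁻ (_∈? J) {xs = run i₀} j∈) , ∈-upTo⁻ c∈ , eq

    ∈-letters⁺ : i₀ ∉ J → ∀ {m} → Letter J m → m ∈ˡ letters J i₀
    ∈-letters⁺ i₀∉J (j , c , j∈J , c<gap , refl) = ∈-concat⁺′ (∈-map⁺ (λ k → j ⊕ + k) (∈-upTo⁺ c<gap))
      (∈-map⁺ block (∈-filter⁺ (_∈? J) (∈-run⁺ (λ j≡i₀ → i₀∉J (subst (_∈ J) j≡i₀ j∈J))) j∈J))

  -- By minimality of the gap, a block meets `Ī` only in its first letter.
  letter-in-Ī : ∀ {J m} → J ⊆ Ī → Letter J m → m ∈ Ī → m ∈ J
  letter-in-Ī J⊆Ī (j , ℕ.zero , j∈J , _ , refl) _ = subst (_∈ _) (sym (⊕-0 j)) j∈J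
  letter-in-Ī J⊆Ī (j , suc c , j∈J , c<gap , refl) m∈Ī =
    contradiction (gap-minimal (J⊆Ī j∈J) ℕ.z<s m∈Ī) (ℕ.<⇒≱ c<gap)

  ∈⇒Letter : ∀ {J j} → J ⊆ Ī → j ∈ J → Letter J j
  ∈⇒Letter {j = j} J⊆Ī j∈J = j , 0 , j∈J , 0<gap (J⊆Ī j∈J) , sym (⊕-0 j)

  Letter-suc : ∀ {J x} → J ⊆ Ī → Letter J x → x ⊕ 1ℤ ∉ Ī → Letter J (x ⊕ 1ℤ)
  Letter-suc {J} {x} J⊆Ī (j , c , j∈J , c<gap , x≡) x+1∉Ī = j , suc c , j∈J , ℕ.≤∧≢⇒< c<gap end , next
    where
    next : x ⊕ 1ℤ ≡ j ⊕ + suc c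
    next = trans (cong (_⊕ 1ℤ) x≡) (sym (⊕-suc j c))
    end : suc c ≢ gap j
    end 1+c≡gap = x+1∉Ī (subst (_∈ Ī) (sym (trans next (cong (λ ℓ → j ⊕ + ℓ) 1+c≡gap))) (⊕-gap-∈ (J⊆Ī j∈J)))

  -- Measured from `i₀`, all letters are at increasing distances between 1 and n - 1, so `precedes`
  -- applies: a block ends before the next one begins (`gap≤`), and before the return to `i₀`, which
  -- lies in `Ī` (`end`).
  letters-ordered : ∀ {J i₀} → J ⊆ Ī → i₀ ∈ Ī → Ordered (letters J i₀)
  letters-ordered {J} {i₀} J⊆Ī i₀∈Ī = AllPairs.concat⁺
    (All.map⁺ (All.tabulate (λ j∈ → within (∈-run⁻ (proj₁ (∈-filter⁻ (_∈? J) j∈)))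
                                           (J⊆Ī (proj₂ (∈-filter⁻ (_∈? J) {xs = run i₀} j∈))))))
    (AllPairs.map⁺ (AllPairs-relative (All.all-filter (_∈? J) (run i₀)) (AllPairs.filter⁺ (_∈? J)
      (AllPairs.map⁺ (AllPairs.applyUpTo⁺₁ id (n ℕ.∸ 1) λ i<j j<n-1 p q →
        across ℕ.z<s (ℕ.s<s i<j) (<pred⇒<n j<n-1) (J⊆Ī p) (J⊆Ī q))))))
    where
    end : ∀ {a} → a ℕ.< n → i₀ ⊕ + a ∈ Ī → a ℕ.+ gap (i₀ ⊕ + a) ℕ.≤ n
    end {a} a<n in-Ī = subst (a ℕ.+ gap (i₀ ⊕ + a) ℕ.≤_) (ℕ.m+[n∸m]≡n (ℕ.<⇒≤ a<n)) (ℕ.+-monoʳ-≤ a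
      (gap-minimal in-Ī (ℕ.m<n⇒0<n∸m a<n) (subst (_∈ Ī) (sym (trans (⊕-⊕ i₀ a (n ℕ.∸ a))
        (trans (cong (λ k → i₀ ⊕ + k) (ℕ.m+[n∸m]≡n (ℕ.<⇒≤ a<n))) (⊕-n i₀)))) i₀∈Ī)))
    within : ∀ {j} → ∃[ k ] 0 ℕ.< k × k ℕ.< n × j ≡ i₀ ⊕ + k → j ∈ Ī → Ordered (block j)
    within (a , 0<a , a<n , refl) in-Ī = AllPairs.map⁺ (AllPairs.applyUpTo⁺₁ id (gap (i₀ ⊕ + a)) λ {c} {c′} c<c′ c′<gap →
      subst₂ Precedes (sym (⊕-⊕ i₀ a c)) (sym (⊕-⊕ i₀ a c′))
        (precedes i₀ (ℕ.<-≤-trans 0<a (ℕ.m≤m+n a c)) (ℕ.+-monoʳ-< a c<c′)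
          (ℕ.<-≤-trans (ℕ.+-monoʳ-< a c′<gap) (end a<n in-Ī))))
    across : ∀ {a a′} → 0 ℕ.< a → a ℕ.< a′ → a′ ℕ.< n → i₀ ⊕ + a ∈ Ī → i₀ ⊕ + a′ ∈ Ī →
             All (λ x → All (Precedes x) (block (i₀ ⊕ + a′))) (block (i₀ ⊕ + a))
    across {a} {a′} 0<a a<a′ a′<n in-Ī in-Ī′ =
      All.map⁺ (All.applyUpTo⁺₁ id (gap (i₀ ⊕ + a)) λ {c} c<gap →
      All.map⁺ (All.applyUpTo⁺₁ id (gap (i₀ ⊕ + a′)) λ {c′} c′<gap →
        subst₂ Precedes (sym (⊕-⊕ i₀ a c)) (sym (⊕-⊕ i₀ a′ c′))
          (precedes i₀ (ℕ.<-≤-trans 0<a (ℕ.m≤m+n a c))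
            (ℕ.<-≤-trans (ℕ.+-monoʳ-< a c<gap) (ℕ.≤-trans gap≤ (ℕ.m≤m+n a′ c′)))
            (ℕ.<-≤-trans (ℕ.+-monoʳ-< a′ c′<gap) (end a′<n in-Ī′)))))
      where
      gap≤ : a ℕ.+ gap (i₀ ⊕ + a) ℕ.≤ a′
      gap≤ = subst (a ℕ.+ gap (i₀ ⊕ + a) ℕ.≤_) (ℕ.m+[n∸m]≡n (ℕ.<⇒≤ a<a′)) (ℕ.+-monoʳ-≤ a
        (gap-minimal in-Ī (ℕ.m<n⇒0<n∸m a<a′) (subst (_∈ Ī) (sym (trans (⊕-⊕ i₀ a (a′ ℕ.∸ a))
          (cong (λ k → i₀ ⊕ + k) (ℕ.m+[n∸m]≡n (ℕ.<⇒≤ a<a′))))) in-Ī′)))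

  -- The letters act from the right, the class of b + m first, and each lowers the image of b + m +
  -- 1 by one.
  run-cycle : ∀ b m → act (∏s (applyUpTo (λ k → class (b + + suc k)) m)) (b + + suc m) ≡ ℤ.suc b
  run-cycle b ℕ.zero  = trans (act-∏s-[] (b + + 1)) (ℤ.+-comm b 1ℤ)
  run-cycle b (suc m) = begin
    act (∏s (x ∷ xs)) (b + + suc (suc m))              ≡⟨ act-∏s-∷ x xs (b + + suc (suc m)) ⟩
    act (s x) (act (∏s xs) (b + + suc (suc m)))        ≡⟨ cong (act (s x)) step ⟩
    act (s x) (ℤ.suc (ℤ.suc b))                        ≡⟨ cong (λ i → act (s i) (ℤ.suc (ℤ.suc b))) (cong class (ℤ.+-comm b 1ℤ)) ⟩
    act (s (class (ℤ.suc b))) (ℤ.suc (ℤ.suc b))        ≡⟨ act-s-down (ℤ.suc b) ⟩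
    ℤ.suc b                                            ∎
    where
    open ≡-Reasoning
    x = class (b + 1ℤ)
    xs = applyUpTo (λ k → class (b + + suc (suc k))) m
    move : ∀ b k → 1ℤ + b + k ≡ b + (1ℤ + k)
    move = solve-∀
    xs≡ : ∀ m (f g : ℕ → ℤ/n) → (∀ k → f k ≡ g k) → applyUpTo f m ≡ applyUpTo g m
    xs≡ ℕ.zero  f g f≗g = refl
    xs≡ (suc m) f g f≗g = cong₂ _∷_ (f≗g 0) (xs≡ m (f ∘ suc) (g ∘ suc) (f≗g ∘ suc))
    step : act (∏s xs) (b + + suc (suc m)) ≡ ℤ.suc (ℤ.suc b)
    step = trans (cong₂ (λ ys → act (∏s ys)) (xs≡ m _ _ (λ k → cong class (sym (move b (+ suc k))))) (sym (move b (+ suc m))))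
                 (run-cycle (ℤ.suc b) m)

  -- Here y is the image of x under τ. The run raises y to y + 1 = x + n, unless y has the absent
  -- class `i₀`; then `run-cycle` brings y down by n - 1, back to x. Since x has the class of y + 1,
  -- the zero coordinate is i₀ + 1.
  act-run : ∀ i₀ x y → ℤ.suc y ≡ x + + n → x + (1ℤ - e (i₀ ⊕ 1ℤ) (class x)) * + n ≡ act (∏s (run i₀)) y
  act-run i₀ x y 1+y≡x+n = main (class y ≟ i₀)
    where
    open ≡-Reasoning
    b = + toℕ i₀
    cycle′ : act (∏s (run i₀)) (b + + n) ≡ ℤ.suc b
    cycle′ = trans (cong₂ (λ xs k → act (∏s xs) (b + + k)) (map-upTo (λ k → i₀ ⊕ + suc k) (n ℕ.∸ 1))
                     (sym (ℕ.suc-pred n {{nonTrivial⇒nonZero n}})))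
                   (run-cycle b (n ℕ.∸ 1))
    class-x : class x ≡ class y ⊕ 1ℤ
    class-x = trans (sym (class-shift x 1ℤ)) (trans (cong class (trans (cong (λ k → x + k) (ℤ.*-identityˡ (+ n))) (sym 1+y≡x+n)))
      (class-suc y))
    main : Dec (class y ≡ i₀) → x + (1ℤ - e (i₀ ⊕ 1ℤ) (class x)) * + n ≡ act (∏s (run i₀)) y
    main (no ≢i₀) = begin
      x + (1ℤ - e (i₀ ⊕ 1ℤ) (class x)) * + n
        ≡⟨ cong (λ d → x + (1ℤ - d) * + n) (e-≢ (λ p → ≢i₀ (⊕1-injective (trans (sym class-x) p)))) ⟩
      x + 1ℤ * + n
        ≡⟨ cong (λ k → x + k) (ℤ.*-identityˡ (+ n)) ⟩
      x + + n
        ≡⟨ 1+y≡x+n ⟨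
      ℤ.suc y
        ≡⟨ ordered-suc y (run-ordered i₀) (∈-run⁺ ≢i₀) ⟨
      act (∏s (run i₀)) y ∎
    main (yes ≡i₀) with class-injective y b (trans ≡i₀ (sym (class-toℕ i₀)))
    ... | k , y≡ = begin
      x + (1ℤ - e (i₀ ⊕ 1ℤ) (class x)) * + n
        ≡⟨ cong (λ d → x + (1ℤ - d) * + n) (trans (cong (e (i₀ ⊕ 1ℤ)) (trans class-x (cong (_⊕ 1ℤ) ≡i₀))) (e-≡ (i₀ ⊕ 1ℤ))) ⟩
      x + 0ℤ * + n
        ≡⟨ regroup₀ x (+ n) ⟩
      x + + n - + n
        ≡⟨ cong (_- + n) (trans (sym 1+y≡x+n) (cong ℤ.suc y≡)) ⟩
      ℤ.suc (b + k * + n) - + n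
        ≡⟨ regroup₁ b k (+ n) ⟩
      ℤ.suc b + (k - 1ℤ) * + n
        ≡⟨ cong (_+ (k - 1ℤ) * + n) cycle′ ⟨
      act (∏s (run i₀)) (b + + n) + (k - 1ℤ) * + n
        ≡⟨ act-shift (∏s (run i₀)) (b + + n) (k - 1ℤ) ⟨
      act (∏s (run i₀)) (b + + n + (k - 1ℤ) * + n)
        ≡⟨ cong (act (∏s (run i₀))) (trans (regroup₂ b k (+ n)) (sym y≡)) ⟩
      act (∏s (run i₀)) y ∎
      where
      regroup₀ : ∀ x m → x + 0ℤ * m ≡ x + m - m
      regroup₀ = solve-∀
      regroup₁ : ∀ b k m → 1ℤ + (b + k * m) - m ≡ 1ℤ + b + (k - 1ℤ) * m
      regroup₁ = solve-∀
      regroup₂ : ∀ b k m → b + m + (k - 1ℤ) * m ≡ b + k * m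
      regroup₂ = solve-∀

  private
    translation≈ : ∀ j t u v → t ≈ t⟨ 1-e j ⨾ 1ℤ ⟩ Perm.id → sim t ≡ sim (u ∙ v) →
      (∀ x → x + (1ℤ - e j (class x)) * + n ≡ act u (act v x)) → t ≈ u ∙ v
    translation≈ j t u v t≈ sim≡ act≡ = act-faithful sim≡ (λ x →
      trans (act-cong t≈ x) (trans (act-translation j x) (trans (act≡ x) (sym (act-∙ u v x)))))

  translation≈run : ∀ i₀ → t⟨ 1-e (i₀ ⊕ 1ℤ) ⨾ 1ℤ ⟩ Perm.id ≈ ∏s (run i₀) ∙ τ
  translation≈run i₀ = translation≈ (i₀ ⊕ 1ℤ) (t⟨ 1-e (i₀ ⊕ 1ℤ) ⨾ 1ℤ ⟩ Perm.id) (∏s (run i₀)) τ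
    (≈-refl {t⟨ 1-e (i₀ ⊕ 1ℤ) ⨾ 1ℤ ⟩ Perm.id})
    (sym (cong₂ _+_ (proj₂ (∏s-Wₐ (run i₀))) (sim≈ τ≈τ₀)))
    (λ x → act-run i₀ x (act τ x) (trans (cong ℤ.suc (act-cong τ≈τ₀ x)) (act-τ₀ x)))

-- Subsets of a finite set.

module _ {n p} {P : Pred (Fin n) p} (P? : Decidable P) where

  ⟦_⟧ : Subset n
  ⟦_⟧ = tabulate (λ i → does (P? i))

  ∈⟦⟧⁺ : ∀ {i} → P i → i ∈ ⟦_⟧
  ∈⟦⟧⁺ {i} Pi = lookup⇒[]= i ⟦_⟧ (trans (lookup∘tabulate (λ j → does (P? j)) i) (dec-true (P? i) Pi))

  ∈⟦⟧⁻ : ∀ {i} → i ∈ ⟦_⟧ → P i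
  ∈⟦⟧⁻ {i} i∈ with P? i | trans (sym (lookup∘tabulate (λ j → does (P? j)) i)) ([]=⇒lookup i∈)
  ... | yes Pi | _ = Pi
  ... | no _   | ()

∈-⋃ : ∀ {n} {i : Fin n} {p ps} → i ∈ p → p ∈ˡ ps → i ∈ ⋃ ps
∈-⋃ {ps = _ ∷ ps} i∈p (here refl)  = p⊆p∪q (⋃ ps) i∈p
∈-⋃ {ps = q ∷ ps} i∈p (there p∈ps) = q⊆p∪q q (⋃ ps) (∈-⋃ i∈p p∈ps)

-- Double cosets of W_I and the isomorphism of posets.

module Cosets (n : ℕ) .{{_ : NonTrivial n}} (Ī : Subset n) where
  open IwahoriWeyl n
  open AffineAction n
  open Words n
  open OrderedWords n
  open Blocks n Ī
  open Parahoric Ī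

  Wₐ-resp : ∀ {u v} → u ≈ v → Wₐ u → Wₐ v
  Wₐ-resp u≈v (d , m) = trans (sym (deg-cong u≈v)) d , trans (sym (sim≈ u≈v)) m

  W_I-Wₐ : ∀ {a} → W_I a → Wₐ a
  W_I-Wₐ (gen (simple {i} _)) = s-Wₐ i
  W_I-Wₐ unit                 = deg-𝟙 , refl
  W_I-Wₐ (mul {g} {h} p q)    = ∙-Wₐ {g} {h} (W_I-Wₐ p) (W_I-Wₐ q)
  W_I-Wₐ (inv {g} p)          = ⁻¹-Wₐ {g} (W_I-Wₐ p)
  W_I-Wₐ (resp g≈h p)         = Wₐ-resp g≈h (W_I-Wₐ p)

  W_I-Preserves : ∀ {a m} → class m ∈ Ī → W_I a → Preserves m a
  W_I-Preserves {m = m} m∈Ī (gen (simple i∉Ī)) = Preserves-s m (λ m≡i → i∉Ī (subst (_∈ Ī) m≡i m∈Ī))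
  W_I-Preserves {m = m} m∈Ī unit              = Preserves-𝟙 m
  W_I-Preserves m∈Ī (mul {g} {h} p q)         = Preserves-∙ g h (W_I-Preserves m∈Ī p) (W_I-Preserves m∈Ī q)
  W_I-Preserves m∈Ī (inv {g} p)               = Preserves-⁻¹ g (W_I-Preserves m∈Ī p)
  W_I-Preserves m∈Ī (resp g≈h p)              = Preserves-cong g≈h (W_I-Preserves m∈Ī p)

  ∼-left : ∀ {a u v} → W_I a → u ≈ a ∙ v → u ∼ v
  ∼-left {a} {u} {v} p eq = a , 𝟙 , p , unit , ≈-trans eq (≈-sym (identityʳ (a ∙ v)))

  ∼-right : ∀ {b u v} → W_I b → u ≈ v ∙ b → u ∼ v
  ∼-right {b} {u} {v} p eq = 𝟙 , b , unit , p , ≈-trans eq (≈-sym (∙-congʳ b (identityˡ v)))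

  ≈⇒∼ : ∀ {u v} → u ≈ v → u ∼ v
  ≈⇒∼ {u} {v} u≈v = ∼-left {𝟙} {u} {v} unit (≈-trans u≈v (≈-sym (identityˡ v)))

  ∼-trans : ∀ u v w → u ∼ v → v ∼ w → u ∼ w
  ∼-trans u v w (a , b , pa , pb , eq) (a′ , b′ , pa′ , pb′ , eq′) =
    a ∙ a′ , b′ ∙ b , mul pa pa′ , mul pb′ pb , (begin
      u                       ≈⟨ eq ⟩
      a ∙ v ∙ b               ≈⟨ ∙-congʳ b (∙-congˡ a eq′) ⟩
      a ∙ (a′ ∙ w ∙ b′) ∙ b   ≈⟨ ∙-congʳ b (assoc a (a′ ∙ w) b′) ⟨
      a ∙ (a′ ∙ w) ∙ b′ ∙ b   ≈⟨ ∙-congʳ b (∙-congʳ b′ (assoc a a′ w)) ⟨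
      a ∙ a′ ∙ w ∙ b′ ∙ b     ≈⟨ assoc (a ∙ a′ ∙ w) b′ b ⟩
      a ∙ a′ ∙ w ∙ (b′ ∙ b)   ∎)
    where open ≈-Reasoning

  ∼-sym : ∀ u v → u ∼ v → v ∼ u
  ∼-sym u v (a , b , pa , pb , eq) = a ⁻¹ , b ⁻¹ , inv pa , inv pb , ≈-sym (begin
      a ⁻¹ ∙ u ∙ b ⁻¹               ≈⟨ ∙-congʳ (b ⁻¹) (∙-congˡ (a ⁻¹) eq) ⟩
      a ⁻¹ ∙ (a ∙ v ∙ b) ∙ b ⁻¹     ≈⟨ ∙-congʳ (b ⁻¹) (∙-congˡ (a ⁻¹) (assoc a v b)) ⟩
      a ⁻¹ ∙ (a ∙ (v ∙ b)) ∙ b ⁻¹   ≈⟨ ∙-congʳ (b ⁻¹) (assoc (a ⁻¹) a (v ∙ b)) ⟨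
      a ⁻¹ ∙ a ∙ (v ∙ b) ∙ b ⁻¹     ≈⟨ ∙-congʳ (b ⁻¹) (∙-congʳ (v ∙ b) (inverseˡ a)) ⟩
      𝟙 ∙ (v ∙ b) ∙ b ⁻¹            ≈⟨ ∙-congʳ (b ⁻¹) (identityˡ (v ∙ b)) ⟩
      v ∙ b ∙ b ⁻¹                  ≈⟨ cancel-inverse v b ⟩
      v                             ∎)
    where open ≈-Reasoning

  opaque
    word : P_I → List ℤ/n
    word (J , _ , i₀ , _) = letters J i₀

    w≈word : ∀ P → w (proj₁ P) (proj₁ (proj₂ (proj₂ P))) ≈ ∏s (word P)
    w≈word (J , _ , i₀ , _) = w≈ J i₀

    word-ordered : ∀ P → Ordered (word P)
    word-ordered (J , J⊆Ī , i₀ , i₀∈Ī , _) = letters-ordered J⊆Ī i₀∈Ī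

    ∈-word⁺ : ∀ P {m} → Letter (proj₁ P) m → m ∈ˡ word P
    ∈-word⁺ (J , _ , i₀ , _ , i₀∉J) = ∈-letters⁺ i₀∉J

    ∈-word⁻ : ∀ P {m} → m ∈ˡ word P → Letter (proj₁ P) m
    ∈-word⁻ (J , _ , i₀ , _) = ∈-letters⁻ {J} {i₀}

  private
    ≤⇒offset : ∀ {x y} → x ℤ.≤ y → ∃[ d ] y ≡ x + + d
    ≤⇒offset {x} {y} x≤y = ℤ.∣ y - x ∣ , trans (regroup x y) (cong (λ d → x + d) (sym (ℤ.0≤i⇒+∣i∣≡i (ℤ.i≤j⇒0≤j-i x≤y))))
      where
      regroup : ∀ x y → y ≡ x + (y - x)
      regroup = solve-∀

    <-offset : ∀ x {d ℓ} → x + + d ℤ.< x + + ℓ → d ℕ.< ℓ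
    <-offset x {d} {ℓ} lt = ℤ.drop‿+<+ (subst₂ ℤ._<_ (cancel x (+ d)) (cancel x (+ ℓ)) (ℤ.+-monoˡ-< (- x) lt))
      where
      cancel : ∀ x d → x + d - x ≡ d
      cancel = solve-∀

  class-minus-n : ∀ x → class (x - + n) ≡ class x
  class-minus-n x = class-cong {x - + n} {x} (- 1ℤ) (regroup x (+ n))
    where
    regroup : ∀ x m → x - m ≡ x + (- 1ℤ) * m
    regroup = solve-∀

  private
    module Crossing {a b : W̃} (pa : W_I a) (pb : W_I b) (u V W ω : W̃) (ys : List ℤ/n)
                    (u≈avb : u ≈ a ∙ V ∙ b) (u≈ : u ≈ ∏s ys ∙ ω)
                    (act-V : ∀ x → act V x ≡ act W (x + (+ n - 1ℤ)))
                    (act-ω : ∀ x → act ω x ≡ x + (+ n - 1ℤ)) where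

      act-u : ∀ z → act u (act (b ⁻¹) (z - (+ n - 1ℤ))) ≡ act a (act W z)
      act-u z = trans (act-cong u≈avb (act (b ⁻¹) x)) (trans (act-∙ (a ∙ V) b (act (b ⁻¹) x))
        (trans (cong (act (a ∙ V)) (act-⁻¹ʳ b x)) (trans (act-∙ a V x)
        (cong (act a) (trans (act-V x) (cong (act W) (cancel z (+ n))))))))
        where
        x = z - (+ n - 1ℤ)
        cancel : ∀ z m → z - (m - 1ℤ) + (m - 1ℤ) ≡ z
        cancel = solve-∀

      act-u′ : ∀ x → act u x ≡ act (∏s ys) (x + (+ n - 1ℤ))
      act-u′ x = trans (act-cong u≈ x) (trans (act-∙ (∏s ys) ω x) (cong (act (∏s ys)) (act-ω x)))

      -- Follow x = z - (n - 1) through u = a ∙ V ∙ b, starting from b ⁻¹. As a preserves the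
      -- half-line up to y, the image is at most y ≤ m; as ys omits m, the shifted argument is at
      -- most m. Undoing the shift by n - 1, and not n, gives the bound m + 1 - n ≤ k - n, whose end
      -- is again preserved by b.
      below-end : ∀ {y m k} → class y ∈ Ī → class k ∈ Ī → y ℤ.≤ m → ℤ.suc m ℤ.≤ k → class m ∉ˡ ys →
                  ∀ z → act W z ℤ.≤ y → ℤ.suc z ℤ.≤ k
      below-end {y} {m} {k} y∈Ī k∈Ī y≤m 1+m≤k m∉ys z Wz≤y =
        subst₂ ℤ._≤_ (raise z (+ n)) (cancel k (+ n)) (ℤ.+-monoˡ-≤ (+ n) x≤k-n)
        where
        raise : ∀ z m → z - (m - 1ℤ) + m ≡ 1ℤ + z
        raise = solve-∀
        cancel : ∀ x m → x - m + m ≡ x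
        cancel = solve-∀
        lower : ∀ x m → x ≡ 1ℤ + (x + (m - 1ℤ)) - m
        lower = solve-∀
        x = z - (+ n - 1ℤ)
        x′ = act (b ⁻¹) x
        ux′≤y : act u x′ ℤ.≤ y
        ux′≤y = subst (ℤ._≤ y) (sym (act-u z)) (proj₁ (W_I-Preserves {m = y} y∈Ī pa (act W z)) Wz≤y)
        x′+n-1≤m : x′ + (+ n - 1ℤ) ℤ.≤ m
        x′+n-1≤m = proj₂ (Preserves-∏s {m} ys m∉ys (x′ + (+ n - 1ℤ)))
          (ℤ.≤-trans (subst (ℤ._≤ y) (act-u′ x′) ux′≤y) y≤m)
        x′≤k-n : x′ ℤ.≤ k - + n
        x′≤k-n = subst (ℤ._≤ k - + n) (sym (lower x′ (+ n)))
          (ℤ.+-monoˡ-≤ (- (+ n)) (ℤ.≤-trans (ℤ.suc-mono x′+n-1≤m) 1+m≤k))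
        x≤k-n : x ℤ.≤ k - + n
        x≤k-n = subst (ℤ._≤ k - + n) (act-⁻¹ʳ b x)
          (proj₁ (W_I-Preserves {m = k - + n} (subst (_∈ Ī) (sym (class-minus-n k)) k∈Ī) pb x′) x′≤k-n)

      crossing : ∀ {y m k} → class y ∈ Ī → class k ∈ Ī → y ℤ.≤ m → m ℤ.< k →
                 ∀ z → k ℤ.≤ z → act W z ℤ.≤ y → class m ∈ˡ ys
      crossing {y} {m} {k} y∈Ī k∈Ī y≤m m<k z k≤z Wz≤y = decidable-stable (class m ∈ˡ? ys) λ m∉ys →
        ℤ.<-irrefl refl (ℤ.<-≤-trans (ℤ.suc[i]≤j⇒i<j
          (below-end {y} {m} {k} y∈Ī k∈Ī y≤m (ℤ.i<j⇒suc[i]≤j m<k) m∉ys z Wz≤y)) k≤z)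

  -- The z supplied by `climb` cannot lie inside the block, since every letter of the block is
  -- raised by one and would stay above j.
  climb-block : ∀ P {j} → j ∈ proj₁ P → ∃[ z ] + toℕ j + + gap j ℤ.≤ z × act (∏s (word P)) z ℤ.≤ + toℕ j
  climb-block P {j} j∈J with climb (word-ordered P) (+ toℕ j)
  ... | z , y≤z , Wz≤y = z , ℤ.≮⇒≥ inside , Wz≤y
    where
    y = + toℕ j
    inside : ¬ z ℤ.< y + + gap j
    inside z<end with ≤⇒offset y≤z
    ... | d , z≡ = ℤ.<-irrefl refl (ℤ.<-≤-trans (ℤ.suc[i]≤j⇒i<j (subst (ℤ._≤ y)
            (ordered-suc z (word-ordered P) (∈-word⁺ P (j , d , j∈J ,
              <-offset y (subst (ℤ._< y + + gap j) z≡ z<end) , cong class z≡))) Wz≤y)) y≤z)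

  -- An abstract V stands for `v`: only its factorisation into an ordered word and τ enters.
  module Isomorphism (V : P_I → W̃) (V≈ : ∀ P → V P ≈ ∏s (word P) ∙ τ) where

    deg-V : ∀ P → deg (V P) ≡ + n - 1ℤ
    deg-V P = trans (deg-cong (V≈ P)) (trans (deg-∙ (∏s (word P)) τ)
      (trans (cong₂ _+_ (proj₁ (∏s-Wₐ (word P))) deg-τ) (ℤ.+-identityˡ (+ n - 1ℤ))))

    act-V : ∀ P x → act (V P) x ≡ act (∏s (word P)) (x + (+ n - 1ℤ))
    act-V P x = trans (act-cong (V≈ P) x) (trans (act-∙ (∏s (word P)) τ x) (cong (act (∏s (word P))) (act-τ x)))

    -- If P contains j then ∏s (word P) maps some z above the block of j to or below
    -- its lower end.  As W_I preserves both ends of the block, every word for an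
    -- element of the double coset of V P has to contain each letter of the block.
    word-⊆ : ∀ P u ys ω → u ∼ V P → Ω ω → u ≈ ∏s ys ∙ ω → ∀ {m} → m ∈ˡ word P → m ∈ˡ ys
    word-⊆ P u ys ω u∼v@(a , b , pa , pb , u≈avb) pω u≈ m∈ with ∈-word⁻ P m∈
    ... | j , c , j∈J , c<gap , refl =
      let z , end≤z , Wz≤y = climb-block P j∈J in
      Crossing.crossing pa pb u (V P) (∏s (word P)) ω ys u≈avb u≈ (act-V P)
        (λ x → trans (act-Ω pω x) (cong (λ d → x + d) deg-ω))
        {+ toℕ j} {+ toℕ j + + c} {+ toℕ j + + gap j}
        (subst (_∈ Ī) (sym (class-toℕ j)) (proj₁ (proj₂ P) j∈J)) (⊕-gap-∈ (proj₁ (proj₂ P) j∈J))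
        (ℤ.i≤i+j (+ toℕ j) (+ c)) (ℤ.+-monoʳ-< (+ toℕ j) (ℤ.+<+ c<gap)) z end≤z Wz≤y
      where
      open ≡-Reasoning
      deg-ω : deg ω ≡ + n - 1ℤ
      deg-ω = begin
        deg ω                           ≡⟨ ℤ.+-identityˡ (deg ω) ⟨
        0ℤ + deg ω                      ≡⟨ cong (_+ deg ω) (proj₁ (∏s-Wₐ ys)) ⟨
        deg (∏s ys) + deg ω             ≡⟨ deg-∙ (∏s ys) ω ⟨
        deg (∏s ys ∙ ω)                 ≡⟨ deg-cong u≈ ⟨
        deg u                           ≡⟨ deg-cong u≈avb ⟩
        deg (a ∙ V P ∙ b)               ≡⟨ deg-∙ (a ∙ V P) b ⟩
        deg (a ∙ V P) + deg b           ≡⟨ cong (_+ deg b) (deg-∙ a (V P)) ⟩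
        deg a + deg (V P) + deg b       ≡⟨ cong₂ (λ d d′ → d + deg (V P) + d′) (proj₁ (W_I-Wₐ pa)) (proj₁ (W_I-Wₐ pb)) ⟩
        0ℤ + deg (V P) + 0ℤ             ≡⟨ trans (ℤ.+-identityʳ _) (ℤ.+-identityˡ (deg (V P))) ⟩
        deg (V P)                       ≡⟨ deg-V P ⟩
        + n - 1ℤ                        ∎

    V-HasLength : ∀ P → HasLength (V P) (length (word P))
    V-HasLength P = ∏s (word P) , τ , ∏s-Wₐ (word P) , τ-Ω , V≈ P ,
      word P , ordered-reduced (word-ordered P) (≈-refl {∏s (word P)}) , refl

    V-minimal : ∀ P → IsMinimalIn (V P) (V P)
    V-minimal P = ≈⇒∼ (≈-refl {V P}) , length (word P) , V-HasLength P ,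
      λ { u _ u∼v (w′ , ω , _ , pω , u≈ , ys , (ys≈ , _) , refl) →
          Unique-length (Ordered⇒Unique (word-ordered P))
            (word-⊆ P u ys ω u∼v pω (≈-∙-trans u w′ (∏s ys) ω u≈ (≈-trans (≈-sym ys≈) (≈-sym (∏s-≈ ys))))) }

    -- P and Q may differ in the base point. Their words are then ordered differently but have the
    -- same letters, hence the same product.
    V-cong : ∀ {P Q} → P ≈P Q → V P ≈ V Q
    V-cong {P} {Q} refl = ≈-trans (≈-∙-trans (V P) (∏s (word P)) (∏s (word Q)) τ (V≈ P)
      (ordered-unique (word-ordered P) (word-ordered Q) (∈-word⁺ Q ∘ ∈-word⁻ P) (∈-word⁺ P ∘ ∈-word⁻ Q)))
      (≈-sym (V≈ Q))

    -- J is recovered from its word as the set of letters lying in `Ī`.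
    word-⊆⇒≤P : ∀ P Q → (∀ {m} → m ∈ˡ word P → m ∈ˡ word Q) → P ≤P Q
    word-⊆⇒≤P P@(_ , J⊆Ī , _) Q@(_ , K⊆Ī , _) sub j∈J =
      letter-in-Ī K⊆Ī (∈-word⁻ Q (sub (∈-word⁺ P (∈⇒Letter J⊆Ī j∈J)))) (J⊆Ī j∈J)

    V-injective : ∀ {P Q} → V P ∼ V Q → P ≈P Q
    V-injective {P} {Q} vP∼vQ = ⊆-antisym (le P Q (∼-sym (V P) (V Q) vP∼vQ)) (le Q P vP∼vQ)
      where
      le : ∀ P Q → V Q ∼ V P → P ≤P Q
      le P Q vQ∼vP = word-⊆⇒≤P P Q (word-⊆ P (V Q) (word Q) τ vQ∼vP (τ-Ω) (V≈ Q))

    ∏s-≤ : ∀ {u v xs ys} → u ≈ ∏s xs ∙ τ → v ≈ ∏s ys ∙ τ → ∏s xs ≤ₐ ∏s ys → u ≤ v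
    ∏s-≤ {xs = xs} {ys} u≈ v≈ le = ∏s xs , τ , ∏s ys , τ ,
      (∏s-Wₐ xs , τ-Ω , u≈) , (∏s-Wₐ ys , τ-Ω , v≈) , ≈-refl {τ} , le

    -- Although xs may fail to be a subword of ys, the letters of xs in the order of ys form a
    -- subword with the same product.
    ordered-mono : ∀ {xs ys} → Ordered xs → Ordered ys → (∀ {m} → m ∈ˡ xs → m ∈ˡ ys) → ∏s xs ≤ₐ ∏s ys
    ordered-mono {xs} {ys} Pxs Pys xs⊆ys =
      inj₁ (ordered-unique Pxs (AllPairs.filter⁺ (_∈ˡ? xs) Pys)
        (λ m∈xs → ∈-filter⁺ (_∈ˡ? xs) (xs⊆ys m∈xs) m∈xs)
        (λ m∈ → proj₂ (∈-filter⁻ (_∈ˡ? xs) {xs = ys} m∈)))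
      ◅ ordered-≤ₐ [] (filter-⊆ (_∈ˡ? xs) ys) Pys

    V-mono : ∀ {P Q} → P ≤P Q → V P ≤∼ V Q
    V-mono {P} {Q} J⊆K = V P , V Q , V-minimal P , V-minimal Q , ∏s-≤ {V P} {V Q} {word P} {word Q} (V≈ P) (V≈ Q)
      (ordered-mono (word-ordered P) (word-ordered Q) (λ m∈ → let j , c , j∈J , c<gap , eq = ∈-word⁻ P m∈ in
        ∈-word⁺ Q (j , c , J⊆K j∈J , c<gap , eq)))

    -- A minimal element of the double coset of V Q has exactly the letters of Q.
    V-cancel : ∀ {P Q} → V P ≤∼ V Q → P ≤P Q
    V-cancel {P} {Q} (u , u′ , (u∼vP , _) , (u′∼vQ , k , (w₁ , ω₁ , pw₁ , pω₁ , u′≈₁ , js , (js≈ , _) , refl) , minimal) ,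
                      w , ω , w′ , ω′ , (pw , pω , u≈) , (pw′ , pω′ , u′≈) , ω≈ω′ , w≤w′) =
      conclude (≤ₐ-subword js w≤w′ w′≈js)
      where
      w′≈js : w′ ≈ ∏s js
      w′≈js = ≈-trans (Wₐ-unique {w′} {w₁} {ω′} {ω₁} pw′ pw₁ pω′ pω₁ (≈-trans (≈-sym u′≈) u′≈₁))
                      (≈-trans (≈-sym js≈) (≈-sym (∏s-≈ js)))
      Q⊆js : ∀ {m} → m ∈ˡ word Q → m ∈ˡ js
      Q⊆js = word-⊆ Q u′ js ω′ u′∼vQ pω′ (≈-∙-trans u′ w′ (∏s js) ω′ u′≈ w′≈js)
      js⊆Q : ∀ {m} → m ∈ˡ js → m ∈ˡ word Q
      -- By minimality `js` is no longer than `word Q`, whose distinct letters it contains; another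
      -- letter would be one too many.
      js⊆Q {m} m∈js = decidable-stable (m ∈ˡ? word Q) λ m∉Q → ℕ.<-irrefl refl (ℕ.≤-trans
        (Unique-length {xs = m ∷ word Q} (All.tabulate (λ z∈ m≡z → m∉Q (subst (_∈ˡ word Q) (sym m≡z) z∈)) ∷ Ordered⇒Unique (word-ordered Q))
          (λ { (here refl) → m∈js ; (there z∈) → Q⊆js z∈ }))
        (minimal (V Q) (length (word Q)) (≈⇒∼ (≈-refl {V Q})) (V-HasLength Q)))
      conclude : (∃[ ys ] ys ⊑ js × w ≈ ∏s ys) → P ≤P Q
      conclude (ys , ys⊑js , w≈ys) = word-⊆⇒≤P P Q
        (λ m∈ → js⊆Q (Sub.lookup ys⊑js (word-⊆ P u ys ω u∼vP pω (≈-∙-trans u w (∏s ys) ω u≈ w≈ys) m∈)))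

    -- The translation is the one whose run omits the base point `i₀` of P. A letter of P in `Ī`
    -- lies in J, so `i₀` is not among the letters of P.
    V-admissible : ∀ P → Admissible (V P)
    V-admissible P@(J , J⊆Ī , i₀ , i₀∈Ī , i₀∉J) = V P ,
      (i₀ ⊕ 1ℤ , ∏s-≤ {V P} {t⟨ 1-e (i₀ ⊕ 1ℤ) ⨾ 1ℤ ⟩ Perm.id} {word P} {run i₀} (V≈ P) (translation≈run i₀)
        (ordered-mono (word-ordered P) (run-ordered i₀) (λ m∈ → ∈-run⁺
          (λ m≡i₀ → i₀∉J (letter-in-Ī J⊆Ī (subst (Letter J) m≡i₀ (∈-word⁻ P m∈)) i₀∈Ī))))) ,
      ≈⇒∼ (≈-refl {V P})

    -- The omitted letter, j - 1 for the translation with zero at j, is kept in the result for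
    -- `missing` below.
    adm-word : ∀ {a} → Adm a → ∃[ ys ] ∃[ i₀ ] Ordered ys × i₀ ∉ˡ ys × a ≈ ∏s ys ∙ τ
    adm-word {a} (j , w , ω , w′ , ω′ , (pw , pω , a≈) , (pw′ , pω′ , t≈) , ω≈ω′ , w≤w′) =
      conclude (≤ₐ-subword (run i₀) w≤w′ (Wₐ-unique {w′} {∏s (run i₀)} {ω′} {τ} pw′ (∏s-Wₐ (run i₀)) pω′ (τ-Ω) factor))
      where
      i₀ = j ⊕ - 1ℤ
      factor : w′ ∙ ω′ ≈ ∏s (run i₀) ∙ τ
      factor = ≈-trans (≈-sym t≈) (subst (λ i → t⟨ 1-e i ⨾ 1ℤ ⟩ Perm.id ≈ ∏s (run i₀) ∙ τ) (⊕-inverse (- 1ℤ) j) (translation≈run i₀))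
      conclude : (∃[ ys ] ys ⊑ run i₀ × w ≈ ∏s ys) → ∃[ ys ] ∃[ i ] Ordered ys × i ∉ˡ ys × a ≈ ∏s ys ∙ τ
      conclude (ys , ys⊑ , w≈ys) = ys , i₀ , AllPairs-⊑ ys⊑ (run-ordered i₀) , (λ i₀∈ → base∉run i₀ (Sub.lookup ys⊑ i₀∈)) ,
        ≈-trans a≈ (∙-cong {w} {∏s ys} {ω} {τ} w≈ys (≈-trans ω≈ω′
          (Ω-unique {w′} {∏s (run i₀)} {ω′} {τ} pw′ (∏s-Wₐ (run i₀)) pω′ (τ-Ω) factor)))

    -- A removable letter can be moved out of ∏s ys ∙ τ to the left (if x − 1 ∉ ys)
    -- or, becoming x + 1 on its way past τ, to the right (if x + 1 ∉ ys).
    Removable : List ℤ/n → ℤ/n → Set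
    Removable ys x = (x ∉ Ī × x ⊕ - 1ℤ ∉ˡ ys) ⊎ (x ⊕ 1ℤ ∉ Ī × x ⊕ 1ℤ ∉ˡ ys)

    removable? : ∀ ys x → Dec (Removable ys x)
    removable? ys x = (¬? (x ∈? Ī) ×-dec ¬? (x ⊕ - 1ℤ ∈ˡ? ys)) ⊎-dec (¬? (x ⊕ 1ℤ ∈? Ī) ×-dec ¬? (x ⊕ 1ℤ ∈ˡ? ys))

    -- Before x the order excludes x + 1, so x - 1 is the only letter that could obstruct the way to
    -- the left; after x it excludes x - 1, so x + 1 is the only obstruction on the right.
    remove : ∀ as x bs → Ordered (as ++ x ∷ bs) → Removable (as ++ x ∷ bs) x → ∏s (as ++ x ∷ bs) ∙ τ ∼ ∏s (as ++ bs) ∙ τ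
    remove as x bs Pys (inj₁ (x∉Ī , x-1∉ys)) = ∼-left {s x} {∏s (as ++ x ∷ bs) ∙ τ} {∏s (as ++ bs) ∙ τ} (gen (simple x∉Ī))
      (≈-trans (∙-congʳ τ (∏s-pull x bs (All.tabulate λ {a} a∈as →
        (λ x≡a → proj₁ (All.lookup before a∈as) (sym x≡a)) ,
        (λ x≡a+1 → x-1∉ys (subst (_∈ˡ as ++ x ∷ bs) (sym (trans (cong (_⊕ - 1ℤ) x≡a+1) (⊕-inverse 1ℤ a))) (∈-++⁺ˡ a∈as))) ,
        proj₂ (All.lookup before a∈as)))) (assoc (s x) (∏s (as ++ bs)) τ))
      where
      before : All (λ a → Precedes a x) as
      before = AllPairs-before as Pys
    remove as x bs Pys (inj₂ (x+1∉Ī , x+1∉ys)) = ∼-right {s (x ⊕ 1ℤ)} {∏s (as ++ x ∷ bs) ∙ τ} {∏s (as ++ bs) ∙ τ} (gen (simple x+1∉Ī))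
      (begin
        ∏s (as ++ x ∷ bs) ∙ τ                ≈⟨ ∙-congʳ τ (∏s-push as x (All.tabulate λ b∈bs →
                                                   proj₁ (All.lookup after b∈bs) , proj₂ (All.lookup after b∈bs) ,
                                                   λ b≡x+1 → x+1∉ys (subst (_∈ˡ as ++ x ∷ bs) b≡x+1 (∈-++⁺ʳ as (there b∈bs))))) ⟩
        ∏s (as ++ bs) ∙ s x ∙ τ              ≈⟨ assoc (∏s (as ++ bs)) (s x) τ ⟩
        ∏s (as ++ bs) ∙ (s x ∙ τ)            ≈⟨ ∙-congˡ (∏s (as ++ bs)) (s-τ x) ⟩
        ∏s (as ++ bs) ∙ (τ ∙ s (x ⊕ 1ℤ))     ≈⟨ assoc (∏s (as ++ bs)) τ (s (x ⊕ 1ℤ)) ⟨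
        ∏s (as ++ bs) ∙ τ ∙ s (x ⊕ 1ℤ)       ∎)
      where
      open ≈-Reasoning
      after : All (Precedes x) bs
      after = AllPairs-after as Pys

    module _ {i} (i∈Ī : i ∈ Ī) where

      -- If nothing can be removed, the letters are closed under steps in both directions inside a
      -- block (`forward`, `backward`), so ys consists of complete blocks.
      module Saturated (ys : List ℤ/n) (Pys : Ordered ys) {m} (m∉ys : m ∉ˡ ys)
                       (saturated : ∀ {x} → x ∈ˡ ys → ¬ Removable ys x) where

        forward : ∀ {x} → x ∈ˡ ys → x ⊕ 1ℤ ∉ Ī → x ⊕ 1ℤ ∈ˡ ys
        forward {x} x∈ys x+1∉Ī = decidable-stable (x ⊕ 1ℤ ∈ˡ? ys) (λ x+1∉ys → saturated x∈ys (inj₂ (x+1∉Ī , x+1∉ys)))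

        backward : ∀ {x} → x ∈ˡ ys → x ∉ Ī → x ⊕ - 1ℤ ∈ˡ ys
        backward {x} x∈ys x∉Ī = decidable-stable (x ⊕ - 1ℤ ∈ˡ? ys) (λ x-1∉ys → saturated x∈ys (inj₁ (x∉Ī , x-1∉ys)))

        opaque
          J : Subset n
          J = ⟦ (λ j → (j ∈? Ī) ×-dec (j ∈ˡ? ys)) ⟧

          ∈J⁺ : ∀ {j} → j ∈ Ī → j ∈ˡ ys → j ∈ J
          ∈J⁺ j∈Ī j∈ys = ∈⟦⟧⁺ (λ j → (j ∈? Ī) ×-dec (j ∈ˡ? ys)) (j∈Ī , j∈ys)

          ∈J⁻ : ∀ {j} → j ∈ J → j ∈ Ī × j ∈ˡ ys
          ∈J⁻ {j} = ∈⟦⟧⁻ (λ j → (j ∈? Ī) ×-dec (j ∈ˡ? ys)) {j}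

        -- This is the base point needed for properness. If all of `Ī` occurred in ys, forward steps
        -- from i would reach every residue, also the absent m.
        missing : ∃[ j ] j ∈ Ī × j ∉ˡ ys
        missing = search (any? (λ j → (j ∈? Ī) ×-dec ¬? (j ∈ˡ? ys)))
          where
          search : Dec (∃[ j ] j ∈ Ī × j ∉ˡ ys) → ∃[ j ] j ∈ Ī × j ∉ˡ ys
          search (yes found) = found
          search (no none)   = contradiction m∈ys m∉ys
            where
            Ī⊆ys : ∀ {j} → j ∈ Ī → j ∈ˡ ys
            Ī⊆ys {j} j∈Ī = decidable-stable (j ∈ˡ? ys) (λ j∉ys → none (j , j∈Ī , j∉ys))
            next : ∀ {x} → x ∈ˡ ys → Dec (x ⊕ 1ℤ ∈ Ī) → x ⊕ 1ℤ ∈ˡ ys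
            next x∈ys (yes in-Ī) = Ī⊆ys in-Ī
            next x∈ys (no ∉Ī)    = forward x∈ys ∉Ī
            all : ∀ k → i ⊕ + k ∈ˡ ys
            all ℕ.zero  = subst (_∈ˡ ys) (sym (⊕-0 i)) (Ī⊆ys i∈Ī)
            all (suc k) = subst (_∈ˡ ys) (sym (⊕-suc i k)) (next (all k) (i ⊕ + k ⊕ 1ℤ ∈? Ī))
            m∈ys : m ∈ˡ ys
            m∈ys = let k , _ , m≡ = ⊕-surjective i m in subst (_∈ˡ ys) (sym m≡) (all k)

        J⊆Ī : J ⊆ Ī
        J⊆Ī j∈J = proj₁ (∈J⁻ j∈J)

        opaque
          P : P_I
          P = J , J⊆Ī , proj₁ missing , proj₁ (proj₂ missing) , λ j∈J → proj₂ (proj₂ missing) (proj₂ (∈J⁻ j∈J))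

          P-J : proj₁ P ≡ J
          P-J = refl

        Letter-J⇒∈ : ∀ {x} → Letter J x → x ∈ˡ ys
        Letter-J⇒∈ (j , c , j∈J , c<gap , refl) = ascend c c<gap
          where
          j∈Ī = proj₁ (∈J⁻ j∈J)
          ascend : ∀ c → c ℕ.< gap j → j ⊕ + c ∈ˡ ys
          ascend ℕ.zero _ = subst (_∈ˡ ys) (sym (⊕-0 j)) (proj₂ (∈J⁻ j∈J))
          ascend (suc c) c<gap = subst (_∈ˡ ys) (sym (⊕-suc j c)) (forward (ascend c (ℕ.<-trans (ℕ.n<1+n c) c<gap))
            (λ ∈Ī → ℕ.<⇒≱ c<gap (gap-minimal j∈Ī ℕ.z<s (subst (_∈ Ī) (sym (⊕-suc j c)) ∈Ī))))

        -- Steps back from x stay in ys until they meet `Ī`, at the first letter of the block.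
        -- Measuring x from i, which lies in `Ī`, makes this an induction.
        ∈⇒Letter-J : ∀ {x} → x ∈ˡ ys → Letter J x
        ∈⇒Letter-J {x} x∈ys = let k , _ , x≡ = ⊕-surjective i x in
          subst (Letter J) (sym x≡) (descend k (subst (_∈ˡ ys) x≡ x∈ys))
          where
          start : ∀ {x} → x ∈ Ī → x ∈ˡ ys → Letter J x
          start x∈Ī x∈ys = ∈⇒Letter J⊆Ī (∈J⁺ x∈Ī x∈ys)
          extend : ∀ {x} → (x ∈ˡ ys → Letter J x) → x ⊕ 1ℤ ∈ˡ ys → Dec (x ⊕ 1ℤ ∈ Ī) → Letter J (x ⊕ 1ℤ)
          extend     _    x+1∈ys (yes in-Ī) = start in-Ī x+1∈ys
          extend {x} prev x+1∈ys (no ∉Ī)    =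
            Letter-suc J⊆Ī (prev (subst (_∈ˡ ys) (⊕-inverse 1ℤ x) (backward x+1∈ys ∉Ī))) ∉Ī
          descend : ∀ k → i ⊕ + k ∈ˡ ys → Letter J (i ⊕ + k)
          descend ℕ.zero  x∈ys = start (subst (_∈ Ī) (sym (⊕-0 i)) i∈Ī) x∈ys
          descend (suc k) x∈ys = subst (Letter J) (sym (⊕-suc i k))
            (extend {i ⊕ + k} (descend k) (subst (_∈ˡ ys) (⊕-suc i k) x∈ys) (i ⊕ + k ⊕ 1ℤ ∈? Ī))

        ∏s≈V : ∏s ys ∙ τ ≈ V P
        ∏s≈V = ≈-sym (≈-∙-trans (V P) (∏s (word P)) (∏s ys) τ (V≈ P)
          (ordered-unique (word-ordered P) Pys
            (λ {x} x∈ → Letter-J⇒∈ (subst (λ K → Letter K x) P-J (∈-word⁻ P x∈)))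
            (λ {x} x∈ → ∈-word⁺ P (subst (λ K → Letter K x) (sym P-J) (∈⇒Letter-J x∈)))))

      reduce-step : ∀ ys → Ordered ys → ∀ {m} → m ∉ˡ ys → (∃ λ P → V P ∼ ∏s ys ∙ τ) ⊎
        (∃ λ zs → suc (length zs) ≡ length ys × Ordered zs × m ∉ˡ zs × ∏s ys ∙ τ ∼ ∏s zs ∙ τ)
      reduce-step ys Pys {m} m∉ys = cases (anyˡ? (removable? ys) ys)
        where
        Shorter : Set
        Shorter = ∃ λ zs → suc (length zs) ≡ length ys × Ordered zs × m ∉ˡ zs × ∏s ys ∙ τ ∼ ∏s zs ∙ τ
        delete : ∀ x → Removable ys x → (∃ λ as → ∃ λ bs → ys ≡ as ++ x ∷ bs) → Shorter
        delete x r (as , bs , refl) = as ++ bs , sym (length-delete as) , AllPairs-delete as Pys ,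
          (λ m∈ → m∉ys (∈-undelete as m∈)) , remove as x bs Pys r
        cases : Dec (Any (Removable ys) ys) → (∃ λ P → V P ∼ ∏s ys ∙ τ) ⊎ Shorter
        cases (no none)  = inj₁ (P , ≈⇒∼ (≈-sym ∏s≈V))
          where open Saturated ys Pys m∉ys (λ x∈ys r → none (lose-∈ x∈ys r))
        cases (yes some) = let x , x∈ys , r = find-∈ some in inj₂ (delete x r (∈-∃++ x∈ys))

      -- Each deletion shortens the word by one and keeps m absent, so `Saturated` applies when no
      -- removable letter is left.
      reduce : ∀ k ys → length ys ≡ k → Ordered ys → ∀ {m} → m ∉ˡ ys → ∃ λ P → V P ∼ ∏s ys ∙ τ
      reduce k ys len Pys {m} m∉ys = continue k len (reduce-step ys Pys m∉ys)
        where
        continue : ∀ k → length ys ≡ k → (∃ λ P → V P ∼ ∏s ys ∙ τ) ⊎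
          (∃ λ zs → suc (length zs) ≡ length ys × Ordered zs × m ∉ˡ zs × ∏s ys ∙ τ ∼ ∏s zs ∙ τ) → ∃ λ P → V P ∼ ∏s ys ∙ τ
        continue _       _   (inj₁ found) = found
        continue ℕ.zero  len (inj₂ (zs , shorter , _)) = contradiction (trans shorter len) (λ ())
        continue (suc k) len (inj₂ (zs , shorter , Pzs , m∉zs , ys∼zs)) =
          let P , vP∼ = reduce k zs (ℕ.suc-injective (trans shorter len)) Pzs m∉zs
          in P , ∼-trans (V P) (∏s zs ∙ τ) (∏s ys ∙ τ) vP∼ (∼-sym (∏s ys ∙ τ) (∏s zs ∙ τ) ys∼zs)

      V-surjective : ∀ u → Admissible u → ∃ λ P → V P ∼ u
      V-surjective u (a , a∈Adm , u∼a) =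
        let ys , i₀ , Pys , i₀∉ys , a≈ = adm-word a∈Adm
            P , vP∼ = reduce (length ys) ys refl Pys i₀∉ys
        in P , ∼-trans (V P) (∏s ys ∙ τ) u vP∼ (∼-trans (∏s ys ∙ τ) a u (≈⇒∼ (≈-sym a≈)) (∼-sym u a u∼a))

      isomorphism : Σ (∀ P → Admissible (V P)) λ v-adm →
                    IsOrderIsomorphism _≈P_ _≈Adm_ _≤P_ _≤Adm_ (λ P → V P , v-adm P)
      isomorphism = V-admissible , record
        { isOrderMonomorphism = record
          { isOrderHomomorphism = record
            { cong = λ {P} {Q} P≈Q → ≈⇒∼ (V-cong {P} {Q} P≈Q)
            ; mono = λ {P} {Q} → V-mono {P} {Q}
            }
          ; injective = λ {P} {Q} → V-injective {P} {Q}
          ; cancel = λ {P} {Q} → V-cancel {P} {Q}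
          }
        ; surjective = λ { (u , u-adm) → let P , vP∼u = V-surjective u u-adm in
            P , λ {Q} Q≈P → ∼-trans (V Q) (V P) u (≈⇒∼ (V-cong {Q} {P} Q≈P)) vP∼u }
        }

  v-def : ∀ P → v P ≈ w (proj₁ P) (proj₁ (proj₂ (proj₂ P))) ∙ τ
  v-def P = mk≈ (λ i → cong (λ x → vec w′ i + x) (sym (vec≈ τ≈τ₀ (perm w′ ⟨$⟩ˡ i))))
                (cong (λ x → sim w′ + x) (sym (sim≈ τ≈τ₀)))
                (λ i → cong (perm w′ ⟨$⟩ʳ_) (sym (perm≈ τ≈τ₀ i)))
    where w′ = w (proj₁ P) (proj₁ (proj₂ (proj₂ P)))

  v≈ : ∀ P → v P ≈ ∏s (word P) ∙ τ
  v≈ P = ≈-∙-trans (v P) (w (proj₁ P) (proj₁ (proj₂ (proj₂ P)))) (∏s (word P)) τ (v-def P) (w≈word P)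

  v-isomorphism : ∀ {i} → i ∈ Ī → Σ (∀ P → Admissible (v P)) λ v-adm →
                  IsOrderIsomorphism _≈P_ _≈Adm_ _≤P_ _≤Adm_ (λ P → v P , v-adm P)
  v-isomorphism = Isomorphism.isomorphism v v≈

-- Non-emptiness of `Ī` and the conclusion.

overline-nonempty : ∀ n .{{_ : NonTrivial n}} (ε : Sign) (I : Subset (suc (ν n ε))) →
                    Nonempty I → Nonempty (IwahoriWeyl.overline n ε I)
overline-nonempty n ε I (r , r∈I) = class (+ toℕ r) ,
  ∈-⋃ (p⊆p∪q ⁅ class (- (+ toℕ r) - + half ε) ⁆ (x∈⁅x⁆ (class (+ toℕ r))))
      (∈-map⁺ (λ r → ⁅ class (+ toℕ r) ⁆ ∪ ⁅ class (- (+ toℕ r) - + half ε) ⁆) (∈-filter⁺ (_∈? I) (∈-allFin r) r∈I))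
  where open IwahoriWeyl n

propositionB : ∀ (n : ℕ) .{{_ : NonTrivial n}} (ε : Sign)
    (I : Subset (suc (ν n ε))) → Nonempty I →
    let open IwahoriWeyl n
        open Parahoric (overline ε I)
    in Σ (∀ J → Admissible (v J)) λ v-adm →
       IsOrderIsomorphism _≈P_ _≈Adm_ _≤P_ _≤Adm_ (λ J → v J , v-adm J)
-- With overline ε I written out for _, Agda would compare it to the copy of
-- overline in the statement by unfolding both.
propositionB n ε I nonempty = Cosets.v-isomorphism n _ (proj₂ (overline-nonempty n ε I nonempty))
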